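{- Let $0<|q|<1$ and let $F_0,F_1,F_2,G_0,G_1,G_2,F_0^{\star},F_1^{\star},F_2^{\star},G_0^{\star},G_1^{\star},G_2^{\star}$ be the double series defined in the context. Then $$F_0(q)=F_1(q)+q^2F_2(q)+1,$$ $$G_0(q)=G_1(q)+q^2G_2(q),$$ $$F_2^{\star}(q)=F_0^{\star}(q)+F_1^{\star}(q)+1,$$ $$G_2^{\star}(q)=G_0^{\star}(q)+G_1^{\star}(q).$$
   Context: Here $q$ is a nonzero complex number with $|q|<1$, and $(x;q)_n=\prod_{i=0}^{n-1}(1-q^ix)$. For $k,l\in\mathbb{Z}$ the Gaussian binomial coefficient is $\begin{bmatrix}k\\ l\end{bmatrix}_q=\frac{(q;q)_k}{(q;q)_l(q;q)_{k-l}}$ if $k\ge l\ge 0$, and $0$ if $l<0$ or $k<l$ (in particular $\begin{bmatrix}-1\\ 0\end{bmatrix}_q=0$). The series are $$F_0(q)=\sum_{a,b\ge 0}\frac{q^{a^2-3ab+3b^2+a-b}}{(q^3;q^3)_b}\begin{bmatrix}3b-a\\ a\end{bmatrix}_q,\qquad G_0(q)=\sum_{a,b\ge 0}\frac{q^{a^2-3ab+3b^2+2b+1}}{(q^3;q^3)_b}\begin{bmatrix}3b-a+1\\ a\end{bmatrix}_q,$$ $$F_1(q)=\sum_{a,b\ge 0}\frac{q^{a^2-3ab+3b^2+a-b}}{(q^3;q^3)_b}\begin{bmatrix}3b-a-1\\ a\end{bmatrix}_q,\qquad G_1(q)=\sum_{a,b\ge 0}\frac{q^{a^2-3ab+3b^2+2b+1}}{(q^3;q^3)_b}\begin{bmatrix}3b-a\\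 a\end{bmatrix}_q,$$ $$F_2(q)=\sum_{a,b\ge 0}\frac{q^{a^2-3ab+3b^2+a-b-2}}{(q^3;q^3)_b}\begin{bmatrix}3b-a-2\\ a\end{bmatrix}_q,\qquad G_2(q)=\sum_{a,b\ge 0}\frac{q^{a^2-3ab+3b^2+2b-1}}{(q^3;q^3)_b}\begin{bmatrix}3b-a-1\\ a\end{bmatrix}_q,$$ $$F_0^{\star}(q)=\sum_{a,b\ge 0}\frac{q^{a^2-3ab+3b^2+a-2b}}{(q^3;q^3)_b}\begin{bmatrix}3b-a-1\\ a\end{bmatrix}_q,\qquad G_0^{\star}(q)=\sum_{a,b\ge 0}\frac{q^{a^2-3ab+3b^2-2a+4b+1}}{(q^3;q^3)_b}\begin{bmatrix}3b-a+2\\ a\end{bmatrix}_q,$$ $$F_1^{\star}(q)=\sum_{a,b\ge 0}\frac{q^{a^2-3ab+3b^2+a-2b}}{(q^3;q^3)_b}\begin{bmatrix}3b-a-2\\ a\end{bmatrix}_q,\qquad G_1^{\star}(q)=\sum_{a,b\ge 0}\frac{q^{a^2-3ab+3b^2-2a+4b+1}}{(q^3;q^3)_b}\begin{bmatrix}3b-a+1\\ a\end{bmatrix}_q,$$ $$F_2^{\star}(q)=\sum_{a,b\ge 0}\frac{q^{a^2-3ab+3b^2+a-2b}}{(q^3;q^3)_b}\begin{bmatrix}3b-a\\ a\end{bmatrix}_q,\qquad G_2^{\star}(q)=\sum_{a,b\ge 0}\frac{q^{a^2-3ab+3b^2-2a+4b+1}}{(q^3;q^3)_b}\begin{bmatrix}3b-a+3\\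 a\end{bmatrix}_q.$$ -}

module Defs where

open import Level using (Level; _⊔_; suc)
import Algebra.Definitions.RawSemiring as SemiringDefinitions
open import Algebra.Bundles using (CommutativeRing; Semiring)
open import Algebra.Apartness.Bundles using (HeytingCommutativeRing; HeytingField)
open import Data.Bool.Base using (if_then_else_)
open import Data.Nat.Base as ℕ using (ℕ; zero)
open import Data.Integer.Base as ℤ using (ℤ; +_; -[1+_])
open import Data.List.Base using (List; map; foldr)
open import Data.List.Relation.Binary.Subset.Propositional using (_⊆_)
open import Data.List.Relation.Unary.Unique.Propositional using (Unique)
open import Data.Product.Base using (_×_; _,_; proj₁; proj₂; ∃-syntax; uncurry)
open import Data.Sum.Base using (_⊎_; inj₁; inj₂; [_,_]′)
open import Function.Bundles using (_⇔_; Equivalence)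
open import Relation.Binary.Core using (Rel)
open import Relation.Binary.Definitions using (Cotransitive)
open import Relation.Binary.Structures using (IsStrictPartialOrder)
open import Relation.Nullary.Negation using (¬_; contradiction)

-- The library has no real numbers.  ℝ is therefore given by its
-- characterisation as the (classically unique) Cauchy complete Archimedean
-- ordered field, in a form that the constructive (Bishop) reals satisfy.

record RealNumbers (c ℓ₁ ℓ₂ : Level) : Set (suc (c ⊔ ℓ₁ ⊔ ℓ₂)) where
  infix 4 _<_ ∣_∣<_
  field
    heytingField : HeytingField c ℓ₁ ℓ₂

  open HeytingField heytingField public
  open HeytingCommutativeRing heytingCommutativeRing public using (commutativeRing)
  open CommutativeRing commutativeRing public using (semiring)
  open Semiring semiring public using (rawSemiring)
  open SemiringDefinitions rawSemiring public
    using () renaming (_×_ to _·_)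

  field
    _<_                  : Rel Carrier ℓ₂
    isStrictPartialOrder : IsStrictPartialOrder _≈_ _<_
    <-cotrans            : Cotransitive _<_
    #⇔<⊎>                : ∀ {x y} → x # y ⇔ (x < y ⊎ y < x)
    +-monoˡ-<            : ∀ {x y} z → x < y → x + z < y + z
    *-pos                : ∀ {x y} → 0# < x → 0# < y → 0# < x * y
    archimedean          : ∀ x → ∃[ n ] x < n · 1#

  ∣_∣<_ : Carrier → Carrier → Set ℓ₂
  ∣ x ∣< ε = - ε < x × x < ε

  IsCauchy : (ℕ → Carrier) → Set (c ⊔ ℓ₂)
  IsCauchy s = ∀ ε → 0# < ε →
    ∃[ N ] ∀ m n → N ℕ.≤ m → N ℕ.≤ n → ∣ s m - s n ∣< ε

  _ConvergesTo_ : (ℕ → Carrier) → Carrier → Set (c ⊔ ℓ₂)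
  s ConvergesTo l = ∀ ε → 0# < ε → ∃[ N ] ∀ n → N ℕ.≤ n → ∣ s n - l ∣< ε

  field
    complete : ∀ s → IsCauchy s → ∃[ l ] s ConvergesTo l

module ComplexNumbers {c ℓ₁ ℓ₂} (ℛ : RealNumbers c ℓ₁ ℓ₂) where

  private
    module R = RealNumbers ℛ
    module RR = CommutativeRing R.commutativeRing
    open import Algebra.Solver.Ring.NaturalCoefficients.Default RR.commutativeSemiring
      using (solve; _:=_; _:+_; _:*_; con)
    open import Algebra.Properties.Ring RR.ring
      using (-0#≈0#; -‿+-comm; -‿distribˡ-*; -‿distribʳ-*; -‿involutive; -1*x≈-x)

  ℝ : Set c
  ℝ = R.Carrier

  open R public using () renaming (_<_ to _<ᵣ_; 0# to 0ᵣ; 1# to 1ᵣ)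

  infix 8 _+i_
  record ℂ : Set c where
    constructor _+i_
    field
      re im : ℝ
  open ℂ public

  infix  4 _≈_
  infixl 6 _+_ _-_
  infixl 7 _*_
  infix  8 -_

  _≈_ : Rel ℂ ℓ₁
  z ≈ w = re z R.≈ re w × im z R.≈ im w

  _+_ _*_ _-_ : ℂ → ℂ → ℂ
  z + w = (re z R.+ re w) +i (im z R.+ im w)
  z * w = (re z R.* re w R.- im z R.* im w) +i (re z R.* im w R.+ im z R.* re w)
  z - w = (re z R.- re w) +i (im z R.- im w)

  -_ : ℂ → ℂ
  - z = (R.- re z) +i (R.- im z)

  0ᶜ 1ᶜ : ℂ
  0ᶜ = 0ᵣ +i 0ᵣ
  1ᶜ = 1ᵣ +i 0ᵣ

  commutativeRing : CommutativeRing c ℓ₁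
  commutativeRing = record
    { Carrier = ℂ ; _≈_ = _≈_ ; _+_ = _+_ ; _*_ = _*_ ; -_ = -_ ; 0# = 0ᶜ ; 1# = 1ᶜ
    ; isCommutativeRing = record
      { isRing = record
        { +-isAbelianGroup = record
          { isGroup = record
            { isMonoid = record
              { isSemigroup = record
                { isMagma = record
                  { isEquivalence = record
                    { refl  = R.refl , R.refl
                    ; sym   = λ (p , q) → R.sym p , R.sym q
                    ; trans = λ (p , q) (r , s) → R.trans p r , R.trans q s
                    }
                  ; ∙-cong = λ (p , q) (r , s) → R.+-cong p r , R.+-cong q s
                  }
                ; assoc = λ _ _ _ → R.+-assoc _ _ _ , R.+-assoc _ _ _
                }
              ; identity = (λ _ → R.+-identityˡ _ , R.+-identityˡ _)
                         , (λ _ → R.+-identityʳ _ , R.+-identityʳ _)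
              }
            ; inverse = (λ _ → R.-‿inverseˡ _ , R.-‿inverseˡ _)
                      , (λ _ → R.-‿inverseʳ _ , R.-‿inverseʳ _)
            ; ⁻¹-cong = λ (p , q) → R.-‿cong p , R.-‿cong q
            }
          ; comm = λ _ _ → R.+-comm _ _ , R.+-comm _ _
          }
        ; *-cong = λ (p , q) (r , s) →
            R.+-cong (R.*-cong p r) (R.-‿cong (R.*-cong q s)) ,
            R.+-cong (R.*-cong p s) (R.*-cong q r)
        ; *-assoc = *-assoc
        ; *-identity = *-identityˡ
                     , λ z → R.trans (proj₁ (*-comm z 1ᶜ)) (proj₁ (*-identityˡ z))
                           , R.trans (proj₂ (*-comm z 1ᶜ)) (proj₂ (*-identityˡ z))
        ; distrib = distribˡ , λ z w v →
            R.trans (proj₁ (*-comm (w + v) z)) (R.trans (proj₁ (distribˡ z w v))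
              (R.+-cong (proj₁ (*-comm z w)) (proj₁ (*-comm z v)))) ,
            R.trans (proj₂ (*-comm (w + v) z)) (R.trans (proj₂ (distribˡ z w v))
              (R.+-cong (proj₂ (*-comm z w)) (proj₂ (*-comm z v))))
        }
      ; *-comm = *-comm
      }
    }
    where
    *-comm : ∀ z w → z * w ≈ w * z
    *-comm z w = R.+-cong (R.*-comm _ _) (R.-‿cong (R.*-comm _ _))
               , R.trans (R.+-comm _ _) (R.+-cong (R.*-comm _ _) (R.*-comm _ _))

    -- The solver is for semirings: -1 is passed to it as a variable m.
    -≈m* : ∀ x → R.- x R.≈ (R.- 1ᵣ) R.* x
    -≈m* x = R.sym (-1*x≈-x x)

    *-assoc : ∀ z w v → (z * w) * v ≈ z * (w * v)
    *-assoc (a +i b) (d +i e) (f +i g) =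
      R.trans (R.+-cong (R.*-cong (R.+-cong R.refl (-≈m* _)) R.refl) (-≈m* _))
      (R.trans
        (solve 7 (λ m a b d e f g →
          (a :* d :+ m :* (b :* e)) :* f :+ m :* ((a :* e :+ b :* d) :* g) :=
          a :* (d :* f :+ m :* (e :* g)) :+ m :* (b :* (d :* g :+ e :* f)))
          R.refl (R.- 1ᵣ) a b d e f g)
        (R.sym (R.+-cong (R.*-cong R.refl (R.+-cong R.refl (-≈m* _))) (-≈m* _)))) ,
      R.trans (R.+-cong (R.*-cong (R.+-cong R.refl (-≈m* _)) R.refl) R.refl)
      (R.trans
        (solve 7 (λ m a b d e f g →
          (a :* d :+ m :* (b :* e)) :* g :+ (a :* e :+ b :* d) :* f :=
          a :* (d :* g :+ e :* f) :+ b :* (d :* f :+ m :* (e :* g)))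
          R.refl (R.- 1ᵣ) a b d e f g)
        (R.sym (R.+-cong R.refl (R.*-cong R.refl (R.+-cong R.refl (-≈m* _))))))

    *-identityˡ : ∀ z → 1ᶜ * z ≈ z
    *-identityˡ z =
      R.trans (R.+-cong (R.*-identityˡ _) (R.trans (R.-‿cong (RR.zeroˡ _)) -0#≈0#))
              (R.+-identityʳ _) ,
      R.trans (R.+-cong (R.*-identityˡ _) (RR.zeroˡ _)) (R.+-identityʳ _)

    distribˡ : ∀ z w v → z * (w + v) ≈ z * w + z * v
    distribˡ (a +i b) (d +i e) (f +i g) =
      R.trans (R.+-cong R.refl (-≈m* _))
      (R.trans
        (solve 7 (λ m a b d e f g →
          a :* (d :+ f) :+ m :* (b :* (e :+ g)) :=
          (a :* d :+ m :* (b :* e)) :+ (a :* f :+ m :* (b :* g)))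
          R.refl (R.- 1ᵣ) a b d e f g)
        (R.sym (R.+-cong (R.+-cong R.refl (-≈m* _)) (R.+-cong R.refl (-≈m* _))))) ,
      solve 6 (λ a b d e f g →
        a :* (e :+ g) :+ b :* (d :+ f) :=
        (a :* e :+ b :* d) :+ (a :* g :+ b :* f)) R.refl a b d e f g

  open SemiringDefinitions
    (Semiring.rawSemiring (CommutativeRing.semiring commutativeRing)) public using (_^_)

  infix 9 ∣_∣²
  ∣_∣² : ℂ → ℝ
  ∣ z ∣² = re z R.* re z R.+ im z R.* im z

  -- The modulus √∣z∣² enters only through comparisons, which are
  -- stated on squares so that no square root has to be constructed.

  infix 4 0<∣_∣ ∣_∣<_

  0<∣_∣ : ℂ → Set ℓ₂
  0<∣ z ∣ = 0ᵣ <ᵣ ∣ z ∣²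

  ∣_∣<_ : ℂ → ℝ → Set ℓ₂
  ∣ z ∣< r = 0ᵣ <ᵣ r × ∣ z ∣² <ᵣ r R.* r

  private
    module < = IsStrictPartialOrder R.isStrictPartialOrder

  <-respʳ : ∀ {x y z} → y R.≈ z → x <ᵣ y → x <ᵣ z
  <-respʳ = proj₁ <.<-resp-≈

  <-respˡ : ∀ {x y z} → y R.≈ z → y <ᵣ x → z <ᵣ x
  <-respˡ = proj₂ <.<-resp-≈

  y-x+x≈y : ∀ x y → (y R.- x) R.+ x R.≈ y
  y-x+x≈y x y = R.trans (R.+-assoc _ _ _)
    (R.trans (R.+-cong R.refl (R.-‿inverseˡ x)) (R.+-identityʳ y))

  x<y⇒0<y-x : ∀ {x y} → x <ᵣ y → 0ᵣ <ᵣ y R.- x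
  x<y⇒0<y-x {x} p = <-respˡ (R.-‿inverseʳ x) (R.+-monoˡ-< (R.- x) p)

  0<y-x⇒x<y : ∀ {x y} → 0ᵣ <ᵣ y R.- x → x <ᵣ y
  0<y-x⇒x<y {x} {y} p =
    <-respˡ (R.+-identityˡ x) (<-respʳ (y-x+x≈y x y) (R.+-monoˡ-< x p))

  x<0⇒0<-x : ∀ {x} → x <ᵣ 0ᵣ → 0ᵣ <ᵣ R.- x
  x<0⇒0<-x p = <-respʳ (R.+-identityˡ _) (x<y⇒0<y-x p)

  square≮0 : ∀ x → ¬ (x R.* x <ᵣ 0ᵣ)
  square≮0 x xx<0 = <.irrefl
    (R.trans (R.*-cong x≈0 R.refl) (RR.zeroˡ x)) xx<0
    where
    0≮x : ¬ (0ᵣ <ᵣ x)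
    0≮x p = <.irrefl R.refl (<.trans xx<0 (R.*-pos p p))
    x≮0 : ¬ (x <ᵣ 0ᵣ)
    x≮0 p = <.irrefl R.refl (<.trans xx<0
      (<-respʳ (R.trans (R.sym (-‿distribˡ-* x _))
                 (R.trans (R.-‿cong (R.sym (-‿distribʳ-* x x))) (-‿involutive _)))
        (R.*-pos (x<0⇒0<-x p) (x<0⇒0<-x p))))
    x≈0 : x R.≈ 0ᵣ
    x≈0 = proj₁ (R.tight x 0ᵣ)
      λ x#0 → [ x≮0 , 0≮x ]′ (Equivalence.to R.#⇔<⊎> x#0)

  nonneg+pos : ∀ {n p} → ¬ (n <ᵣ 0ᵣ) → 0ᵣ <ᵣ p → 0ᵣ <ᵣ n R.+ p
  nonneg+pos {n} {p} n≮0 0<p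
    with R.<-cotrans (<-respˡ (R.+-identityˡ n)
           (<-respʳ (R.+-comm p n) (R.+-monoˡ-< n 0<p))) 0ᵣ
  ... | inj₁ n<0   = contradiction n<0 n≮0
  ... | inj₂ 0<n+p = 0<n+p

  re<1 : ∀ z → ∣ z ∣² <ᵣ 1ᵣ → re z <ᵣ 1ᵣ
  re<1 (x +i y) p with R.<-cotrans xx<1 x
    where
    xx<1 : x R.* x <ᵣ 1ᵣ
    xx<1 = 0<y-x⇒x<y (<-respʳ eq (nonneg+pos (square≮0 y) (x<y⇒0<y-x p)))
      where
      eq : y R.* y R.+ (1ᵣ R.- (x R.* x R.+ y R.* y)) R.≈ 1ᵣ R.- x R.* x
      eq = R.trans
        (R.trans (R.+-comm _ _) (R.+-cong
          (R.trans (R.+-cong R.refl (R.sym (-‿+-comm _ _))) (R.sym (R.+-assoc _ _ _)))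
          R.refl))
        (y-x+x≈y (y R.* y) _)
  ... | inj₂ x<1  = x<1
  ... | inj₁ xx<x =
    0<y-x⇒x<y (<-respʳ eq (nonneg+pos (square≮0 (1ᵣ R.- x)) (x<y⇒0<y-x xx<x)))
    where
    eq : (1ᵣ R.- x) R.* (1ᵣ R.- x) R.+ (x R.- x R.* x) R.≈ 1ᵣ R.- x
    eq = R.trans (R.+-cong R.refl (R.trans
           (R.+-cong (R.sym (R.*-identityˡ x)) (-‿distribˡ-* x x))
           (R.sym (R.distribʳ x 1ᵣ (R.- x)))))
         (R.trans (R.sym (R.distribˡ (1ᵣ R.- x) (1ᵣ R.- x) x))
         (R.trans (R.*-cong R.refl (y-x+x≈y x 1ᵣ)) (R.*-identityʳ _)))

  ∣zw∣² : ∀ z w → ∣ z * w ∣² R.≈ ∣ z ∣² R.* ∣ w ∣²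
  ∣zw∣² (a +i b) (d +i e) =
    R.trans (R.+-cong (R.*-cong -≈m -≈m) R.refl)
    (R.trans
      (solve 5 (λ m a b d e →
        (a :* d :+ m :* (b :* e)) :* (a :* d :+ m :* (b :* e)) :+
          (a :* e :+ b :* d) :* (a :* e :+ b :* d) :=
        (a :* a) :* (d :* d) :+ (m :* m) :* ((b :* b) :* (e :* e)) :+
          (a :* a) :* (e :* e) :+ (b :* b) :* (d :* d) :+
          (con 1 :+ m) :* (con 2 :* (a :* b :* d :* e)))
        R.refl m a b d e)
    (R.trans
      (R.+-cong (R.+-cong (R.+-cong (R.+-cong R.refl (R.*-cong mm≈1 R.refl)) R.refl) R.refl)
        (R.trans (R.*-cong (R.-‿inverseʳ 1ᵣ) R.refl) (RR.zeroˡ _)))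
      (solve 4 (λ a b d e →
        (a :* a) :* (d :* d) :+ con 1 :* ((b :* b) :* (e :* e)) :+
          (a :* a) :* (e :* e) :+ (b :* b) :* (d :* d) :+ con 0 :=
        (a :* a :+ b :* b) :* (d :* d :+ e :* e))
        R.refl a b d e)))
    where
    m = R.- 1ᵣ
    -≈m : a R.* d R.- b R.* e R.≈ a R.* d R.+ m R.* (b R.* e)
    -≈m = R.+-cong R.refl (R.sym (-1*x≈-x _))
    mm≈1 : m R.* m R.≈ 1ᵣ
    mm≈1 = R.trans (-1*x≈-x m) (-‿involutive 1ᵣ)

  ∣1∣² : ∣ 1ᶜ ∣² R.≈ 1ᵣ
  ∣1∣² = R.trans (R.+-cong (R.*-identityˡ _) (RR.zeroˡ _)) (R.+-identityʳ _)

  0<1 : 0ᵣ <ᵣ 1ᵣ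
  0<1 with Equivalence.to R.#⇔<⊎> 1#0
    where open import Algebra.Apartness.Properties.HeytingCommutativeRing
                R.heytingCommutativeRing using (1#0)
  ... | inj₂ p = p
  ... | inj₁ p = contradiction (<-respˡ (R.sym (R.*-identityˡ 1ᵣ)) p) (square≮0 1ᵣ)

  0<∣1∣ : 0<∣ 1ᶜ ∣
  0<∣1∣ = <-respʳ (R.sym ∣1∣²) 0<1

  0<∣zw∣ : ∀ {z w} → 0<∣ z ∣ → 0<∣ w ∣ → 0<∣ z * w ∣
  0<∣zw∣ {z} {w} p q = <-respʳ (R.sym (∣zw∣² z w)) (R.*-pos p q)

  0<∣z^n∣ : ∀ {z} n → 0<∣ z ∣ → 0<∣ z ^ n ∣
  0<∣z^n∣ zero      p = 0<∣1∣
  0<∣z^n∣ (ℕ.suc n) p = 0<∣zw∣ p (0<∣z^n∣ n p)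

  ∣z^1+n∣<1 : ∀ {z} n → 0<∣ z ∣ → ∣ z ∣< 1ᵣ → ∣ z ^ ℕ.suc n ∣< 1ᵣ
  ∣z^1+n∣<1 {z} zero 0<z (0<1' , z<1) = 0<1' ,
    <-respˡ (R.sym (R.trans (∣zw∣² z 1ᶜ)
      (R.trans (R.*-cong R.refl ∣1∣²) (R.*-identityʳ _)))) z<1
  ∣z^1+n∣<1 {z} (ℕ.suc n) 0<z ∣z∣<1 = proj₁ ∣z∣<1 , <.trans
    (0<y-x⇒x<y (<-respʳ eq
      (R.*-pos 0<z (x<y⇒0<y-x (<-respʳ (R.*-identityˡ 1ᵣ) (proj₂ (∣z^1+n∣<1 n 0<z ∣z∣<1)))))))
    (proj₂ ∣z∣<1)
    where
    eq : ∣ z ∣² R.* (1ᵣ R.- ∣ z ^ ℕ.suc n ∣²) R.≈ ∣ z ∣² R.- ∣ z * z ^ ℕ.suc n ∣²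
    eq = R.trans (R.distribˡ _ _ _) (R.+-cong (R.*-identityʳ _)
      (R.trans (R.sym (-‿distribʳ-* _ _)) (R.-‿cong (R.sym (∣zw∣² z _)))))

  0<∣1-z∣ : ∀ {z} → ∣ z ∣< 1ᵣ → 0<∣ 1ᶜ - z ∣
  0<∣1-z∣ {z} (_ , p) = <-respʳ (R.+-comm _ _)
    (nonneg+pos (square≮0 (0ᵣ R.- im z)) (R.*-pos 0<1-x 0<1-x))
    where
    0<1-x : 0ᵣ <ᵣ 1ᵣ R.- re z
    0<1-x = x<y⇒0<y-x (re<1 z (<-respʳ (R.*-identityˡ 1ᵣ) p))

  infix 8 _⁻¹[_]
  _⁻¹[_] : (z : ℂ) → 0<∣ z ∣ → ℂ
  z ⁻¹[ p ] = (re z R.* r) +i (R.- im z R.* r)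
    where
    r : ℝ
    r = proj₁ (R.#⇒invertible (Equivalence.from R.#⇔<⊎> (inj₂ p)))

  infixl 7 _/_[_]
  _/_[_] : ℂ → (z : ℂ) → 0<∣ z ∣ → ℂ
  w / z [ p ] = w * z ⁻¹[ p ]

  ∑ : List (ℕ × ℕ) → (ℕ → ℕ → ℂ) → ℂ
  ∑ T f = foldr _+_ 0ᶜ (map (uncurry f) T)

  -- Unconditional convergence over ℕ × ℕ: the sums over all sufficiently
  -- large finite sets of indices (duplicate-free lists) tend to s.

  infix 4 _HasSum_
  _HasSum_ : (ℕ → ℕ → ℂ) → ℂ → Set (c ⊔ ℓ₂)
  f HasSum s = ∀ ε → 0ᵣ <ᵣ ε →
    ∃[ S ] ∀ T → Unique T → S ⊆ T → ∣ ∑ T f - s ∣< ε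

  Summable : (ℕ → ℕ → ℂ) → Set (c ⊔ ℓ₂)
  Summable f = ∃[ s ] f HasSum s

  -- (x ⨾ q) n is ∏_{i<n} (1 - qⁱ x).

  infix 5 _⨾_
  _⨾_ : ℂ → ℂ → ℕ → ℂ
  (x ⨾ q) zero      = 1ᶜ
  (x ⨾ q) (ℕ.suc n) = (x ⨾ q) n * (1ᶜ - q ^ n * x)

  0<∣⨾∣ : ∀ {q} → 0<∣ q ∣ → ∣ q ∣< 1ᵣ → ∀ n → 0<∣ (q ⨾ q) n ∣
  0<∣⨾∣ {q} 0<q q<1 zero      = 0<∣1∣
  0<∣⨾∣ {q} 0<q q<1 (ℕ.suc n) = 0<∣zw∣ (0<∣⨾∣ 0<q q<1 n) (0<∣1-z∣ (proj₁ q<1 ,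
    <-respˡ (R.trans (∣zw∣² q (q ^ n)) (R.trans (R.*-comm _ _) (R.sym (∣zw∣² (q ^ n) q))))
      (proj₂ (∣z^1+n∣<1 n 0<q q<1))))

data Label : Set where
  F₀ F₁ F₂ G₀ G₁ G₂ F₀⋆ F₁⋆ F₂⋆ G₀⋆ G₁⋆ G₂⋆ : Label

module DoubleSeries {c ℓ₁ ℓ₂} (ℛ : RealNumbers c ℓ₁ ℓ₂)
  (q : ComplexNumbers.ℂ ℛ)
  (0<∣q∣ : ComplexNumbers.0<∣_∣ ℛ q)
  (∣q∣<1 : ComplexNumbers.∣_∣<_ ℛ q (RealNumbers.1# ℛ)) where

  private module Cx = ComplexNumbers ℛ
  open ComplexNumbers ℛ hiding (_+_; _*_; _-_; -_)
  open import Data.Integer.Base using (_+_; _*_; _-_)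

  q^_ : ℤ → ℂ
  q^ (+ n)     = q ^ n
  q^ -[1+ n ]  = (q ⁻¹[ 0<∣q∣ ]) ^ ℕ.suc n

  gauss : ℤ → ℤ → ℂ
  gauss (+ k) (+ l) =
    if l ℕ.≤ᵇ k
    then (q ⨾ q) k / (q ⨾ q) l Cx.* (q ⨾ q) (k ℕ.∸ l)
           [ 0<∣zw∣ (0<∣⨾∣ 0<∣q∣ ∣q∣<1 l) (0<∣⨾∣ 0<∣q∣ ∣q∣<1 (k ℕ.∸ l)) ]
    else 0ᶜ
  gauss (+ k)    -[1+ l ] = 0ᶜ
  gauss -[1+ k ] l        = 0ᶜ

  -- The exponent of q is a² - 3ab + 3b² + e and the binomial is [ k over a ].

  summand : (e k : ℤ) (a b : ℕ) → ℂ
  summand e k a b =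
    q^ (+ a * + a - + 3 * + a * + b + + 3 * + b * + b + e)
      / (q ^ 3 ⨾ q ^ 3) b [ 0<∣⨾∣ (0<∣z^n∣ 3 0<∣q∣) (∣z^1+n∣<1 2 0<∣q∣ ∣q∣<1) b ]
      Cx.* gauss k (+ a)

  term : Label → ℕ → ℕ → ℂ
  term F₀  a b = summand (+ a - + b)                   (+ 3 * + b - + a)       a b
  term G₀  a b = summand (+ 2 * + b + + 1)             (+ 3 * + b - + a + + 1) a b
  term F₁  a b = summand (+ a - + b)                   (+ 3 * + b - + a - + 1) a b
  term G₁  a b = summand (+ 2 * + b + + 1)             (+ 3 * + b - + a)       a b
  term F₂  a b = summand (+ a - + b - + 2)             (+ 3 * + b - + a - + 2) a b
  term G₂  a b = summand (+ 2 * + b - + 1)             (+ 3 * + b - + a - + 1) a b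
  term F₀⋆ a b = summand (+ a - + 2 * + b)             (+ 3 * + b - + a - + 1) a b
  term G₀⋆ a b = summand (+ 4 * + b - + 2 * + a + + 1) (+ 3 * + b - + a + + 2) a b
  term F₁⋆ a b = summand (+ a - + 2 * + b)             (+ 3 * + b - + a - + 2) a b
  term G₁⋆ a b = summand (+ 4 * + b - + 2 * + a + + 1) (+ 3 * + b - + a + + 1) a b
  term F₂⋆ a b = summand (+ a - + 2 * + b)             (+ 3 * + b - + a)       a b
  term G₂⋆ a b = summand (+ 4 * + b - + 2 * + a + + 1) (+ 3 * + b - + a + + 3) a b

{-# OPTIONS --safe #-}
module Submission where

-- Consider one of the four identities, let b be given, and let K be the upper
-- index of the Gaussian binomial in the summand at (a + 1 , b) of the series on
-- the left.  The recurrence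
--   [ K , a + 1 ] = [ K - 1 , a + 1 ] + q^(K - 1 - a) [ K - 1 , a ]
-- splits the summand at (a + 1 , b) into the summand of the second series at
-- (a + 1 , b) and, because the power of q combines with the quadratic form
-- a² - 3ab + 3b² in the exponent, the summand of the third series at (a , b)
-- (times q² in the identities for F and G).  This is cell-pascal, and
-- Recurrence records the four matchings of exponents and indices.  At (0 , b)
-- the summands of the first two series agree as long as the upper index on the
-- left is not 0, both binomials being 1.  That index vanishes only in the
-- identities for F and F⋆, at a = b = 0, where [ 0 , 0 ] = 1 but [ -1 , 0 ] = 0:
-- this is the constant 1 in those identities.
-- Unconditional sums are additive and invariant under the translation
-- (a , b) ↦ (a + 1 , b) of the indices, and they are unique (HasSum-+,
-- HasSum-delay, HasSum-unique), so the pointwise relations give the relations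
-- between the sums.
--
-- Convergence: put t = |q|².  The recurrence and |z + w|² ≤ 2 (|z|² + |w|²)
-- give |[ k , a ]|² ≤ 4^k for k ≥ 0, and |1 - z|² is bounded below for
-- |z|² ≤ t, so that all factors of a summand except the power of q are at most
-- exponential in a + b.  The form a² - 3ab + 3b² is positive definite, hence
-- the power of q decays faster than any exponential (form-dominates), and the
-- summand is at most a constant times 2^-(a + b) (cell-bound).  Such a family
-- has a sum: its sums over the boxes [0 , n) × [0 , n) are Cauchy, and the sum
-- over any finite set that contains a box is close to the one over the box
-- (dominated⇒summable).  All moduli enter through their squares, and
-- inequalities x ≤ y are read as the negation of y < x, which makes them stable
-- under double negation and allows case distinctions in their proofs.

open import Defs
open import Level using (Level)
open import Data.Product.Base using (_×_)
open import Algebra.Bundles using (CommutativeRing)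
open import Data.Bool.Base as Bool using (true; false; if_then_else_)
open import Data.Integer.Base as ℤ using (ℤ; +_; -[1+_])
import Data.Integer.Properties as ℤ
open import Data.Integer.Solver using (module +-*-Solver)
open import Data.List.Base using (List; []; _∷_; _++_; map; foldr; downFrom; cartesianProduct)
open import Data.List.Membership.Propositional using (_∈_)
open import Data.List.Membership.Propositional.Properties
  using (∈-∃++; ∈-map⁺; ∈-++⁺ˡ; ∈-++⁺ʳ; ∈-cartesianProduct⁺; ∈-cartesianProduct⁻;
    ∈-downFrom⁺; ∈-downFrom⁻)
open import Data.List.Relation.Binary.Permutation.Propositional
  using (_↭_; ↭⇒↭ₛ′; prep; ↭-refl; ↭-trans)
open import Data.List.Relation.Binary.Permutation.Propositional.Properties
  using (shift; ∈-resp-↭) renaming (map⁺ to ↭-map⁺)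
import Data.List.Relation.Binary.Permutation.Setoid.Properties as Permutation
open import Data.List.Relation.Binary.Subset.Propositional using (_⊆_)
open import Data.List.Relation.Unary.All as All using (All; []; _∷_)
open import Data.List.Relation.Unary.AllPairs using ([]; _∷_)
open import Data.List.Relation.Unary.Any using (here; there)
open import Data.List.Relation.Unary.Unique.Propositional using (Unique)
import Data.List.Relation.Unary.Unique.Propositional.Properties as Unique
open import Data.Nat.Base as ℕ using (ℕ; zero; suc)
import Data.Nat.Properties as ℕ
import Data.Nat.Solver
open import Data.Product.Base using (_,_; proj₁; proj₂; ∃-syntax; uncurry)
import Data.Sign.Base as Sign
open import Data.Sum.Base using (_⊎_; inj₁; inj₂; [_,_]′)
open import Function.Base using (_∘_)
open import Function.Bundles using (Equivalence)
open import Relation.Binary.Definitions using (Tri; tri<; tri≈; tri>)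
open import Relation.Binary.PropositionalEquality as ≡ using (_≡_; _≢_)
open import Relation.Binary.Structures using (IsStrictPartialOrder)
open import Relation.Nullary.Negation using (¬_; contradiction)

-- Polynomial identities in commutative rings

-- The ring solver for an arbitrary commutative ring, with integer coefficients.
-- Their equality is decidable, so that cancellation is recognised.
module IntegerCoefficients {c ℓ} (R : CommutativeRing c ℓ) where

  open CommutativeRing R hiding (zero)
  open import Algebra.Properties.Ring ring
    using (-0#≈0#; -‿+-comm; -‿distribˡ-*; -‿distribʳ-*; -‿involutive)
  open import Algebra.Properties.Semiring.Mult.TCOptimised semiring
    using (×-homo-+; ×1-homo-*; 1+×) renaming (_×_ to _·_)
  open import Relation.Binary.Reasoning.Setoid setoid
  open import Algebra.Solver.Ring.AlmostCommutativeRing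
    using (fromCommutativeRing; _-Raw-AlmostCommutative⟶_)
  open import Data.Maybe.Base using (Maybe; just; nothing)
  open import Relation.Nullary.Decidable.Core using (yes; no)

  -- The homomorphism from ℤ.
  ⟦_⟧ᶻ : ℤ → Carrier
  ⟦ + n ⟧ᶻ      = n · 1#
  ⟦ -[1+ n ] ⟧ᶻ = - (suc n · 1#)

  private
    signed : Sign.Sign → Carrier → Carrier
    signed Sign.+ x = x
    signed Sign.- x = - x

    ⟦◃⟧ : ∀ s n → ⟦ s ℤ.◃ n ⟧ᶻ ≈ signed s (n · 1#)
    ⟦◃⟧ Sign.+ zero    = refl
    ⟦◃⟧ Sign.+ (suc n) = refl
    ⟦◃⟧ Sign.- zero    = sym -0#≈0#
    ⟦◃⟧ Sign.- (suc n) = refl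

    ⟦⊖⟧ : ∀ m n → ⟦ m ℤ.⊖ n ⟧ᶻ ≈ m · 1# - n · 1#
    ⟦⊖⟧ zero    zero    = sym (-‿inverseʳ 0#)
    ⟦⊖⟧ zero    (suc n) = sym (+-identityˡ _)
    ⟦⊖⟧ (suc m) zero    = sym (trans (+-congˡ -0#≈0#) (+-identityʳ _))
    ⟦⊖⟧ (suc m) (suc n) = begin
      ⟦ suc m ℤ.⊖ suc n ⟧ᶻ            ≡⟨ ≡.cong ⟦_⟧ᶻ (ℤ.[1+m]⊖[1+n]≡m⊖n m n) ⟩
      ⟦ m ℤ.⊖ n ⟧ᶻ                    ≈⟨ ⟦⊖⟧ m n ⟩
      x - y                           ≈⟨ +-congˡ (+-identityˡ _) ⟨
      x + (0# - y)                    ≈⟨ +-congˡ (+-congʳ (-‿inverseʳ 1#)) ⟨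
      x + ((1# - 1#) - y)             ≈⟨ +-congˡ (+-assoc _ _ _) ⟩
      x + (1# + (- 1# - y))           ≈⟨ +-assoc _ _ _ ⟨
      (x + 1#) + (- 1# - y)           ≈⟨ +-cong (+-comm _ _) (-‿+-comm 1# y) ⟩
      (1# + x) - (1# + y)             ≈⟨ +-cong (1+× m 1#) (-‿cong (1+× n 1#)) ⟨
      suc m · 1# - suc n · 1#         ∎
      where
      x = m · 1#
      y = n · 1#

    +-homo : ∀ i j → ⟦ i ℤ.+ j ⟧ᶻ ≈ ⟦ i ⟧ᶻ + ⟦ j ⟧ᶻ
    +-homo (+ m)    (+ n)    = ×-homo-+ 1# m n
    +-homo (+ m)    -[1+ n ] = ⟦⊖⟧ m (suc n)
    +-homo -[1+ m ] (+ n)    = trans (⟦⊖⟧ n (suc m)) (+-comm _ _)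
    +-homo -[1+ m ] -[1+ n ] = begin
      - (suc (suc (m ℕ.+ n)) · 1#)       ≡⟨ ≡.cong (λ k → - (k · 1#)) (ℕ.+-suc (suc m) n) ⟨
      - ((suc m ℕ.+ suc n) · 1#)         ≈⟨ -‿cong (×-homo-+ 1# (suc m) (suc n)) ⟩
      - (suc m · 1# + suc n · 1#)        ≈⟨ -‿+-comm _ _ ⟨
      - (suc m · 1#) - (suc n · 1#)      ∎

    *-homo : ∀ i j → ⟦ i ℤ.* j ⟧ᶻ ≈ ⟦ i ⟧ᶻ * ⟦ j ⟧ᶻ
    *-homo (+ m)    (+ n)    = trans (⟦◃⟧ Sign.+ (m ℕ.* n)) (×1-homo-* m n)
    *-homo (+ m)    -[1+ n ] = trans (⟦◃⟧ Sign.- (m ℕ.* suc n))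
      (trans (-‿cong (×1-homo-* m (suc n))) (-‿distribʳ-* _ _))
    *-homo -[1+ m ] (+ n)    = trans (⟦◃⟧ Sign.- (suc m ℕ.* n))
      (trans (-‿cong (×1-homo-* (suc m) n)) (-‿distribˡ-* _ _))
    *-homo -[1+ m ] -[1+ n ] = trans (×1-homo-* (suc m) (suc n))
      (trans (sym (-‿involutive _)) (trans (-‿cong (-‿distribˡ-* _ _)) (-‿distribʳ-* _ _)))

    -‿homo : ∀ i → ⟦ ℤ.- i ⟧ᶻ ≈ - ⟦ i ⟧ᶻ
    -‿homo (+ zero)   = sym -0#≈0#
    -‿homo (+ suc n)  = refl
    -‿homo -[1+ n ]   = sym (-‿involutive _)

    homomorphism : ℤ.+-*-rawRing -Raw-AlmostCommutative⟶ fromCommutativeRing R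
    homomorphism = record
      { ⟦_⟧    = ⟦_⟧ᶻ
      ; +-homo = +-homo
      ; *-homo = *-homo
      ; -‿homo = -‿homo
      ; 0-homo = refl
      ; 1-homo = refl
      }

    weaklyDecide : ∀ i j → Maybe (⟦ i ⟧ᶻ ≈ ⟦ j ⟧ᶻ)
    weaklyDecide i j with i ℤ.≟ j
    ... | yes i≡j = just (reflexive (≡.cong ⟦_⟧ᶻ i≡j))
    ... | no  _   = nothing

  open import Algebra.Solver.Ring
    ℤ.+-*-rawRing (fromCommutativeRing R) homomorphism weaklyDecide public
    using (solve; _:=_; _:+_; _:*_; _:-_; :-_; con)

-- The order of the real numbers
module RealOrder {c ℓ₁ ℓ₂} (ℛ : RealNumbers c ℓ₁ ℓ₂) where

  private
    module R = RealNumbers ℛ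
    module < = IsStrictPartialOrder R.isStrictPartialOrder
  open CommutativeRing R.commutativeRing hiding (zero)
  open R using (_<_; _·_)
  open ComplexNumbers ℛ
    using (<-respˡ; <-respʳ; x<y⇒0<y-x; 0<y-x⇒x<y; x<0⇒0<-x; nonneg+pos; 0<1)
  open import Algebra.Definitions.RawSemiring R.rawSemiring using (_^_)
  open import Algebra.Properties.Semiring.Exp semiring using (^-homo-*; ^-congˡ)
  open import Algebra.Properties.CommutativeSemiring.Exp commutativeSemiring
    using (^-distrib-*)
  open IntegerCoefficients R.commutativeRing

  -- Non-strict inequality, as the negation of the converse strict one; the
  -- constructive disjunction of < and ≈ would be too strong.
  infix 4 _≤_
  _≤_ : Carrier → Carrier → Set ℓ₂
  x ≤ y = ¬ y < x

  <⇒≤ : ∀ {x y} → x < y → x ≤ y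
  <⇒≤ x<y y<x = <.irrefl refl (<.trans x<y y<x)

  ≤-reflexive : ∀ {x y} → x ≈ y → x ≤ y
  ≤-reflexive x≈y y<x = <.irrefl (sym x≈y) y<x

  ≤-refl : ∀ {x} → x ≤ x
  ≤-refl = ≤-reflexive refl

  ≤-trans : ∀ {x y z} → x ≤ y → y ≤ z → x ≤ z
  ≤-trans {y = y} x≤y y≤z z<x = [ y≤z , x≤y ]′ (R.<-cotrans z<x y)

  <-≤-trans : ∀ {x y z} → x < y → y ≤ z → x < z
  <-≤-trans {z = z} x<y y≤z with R.<-cotrans x<y z
  ... | inj₁ x<z = x<z
  ... | inj₂ z<y = contradiction z<y y≤z

  ≤-<-trans : ∀ {x y z} → x ≤ y → y < z → x < z
  ≤-<-trans {x = x} x≤y y<z with R.<-cotrans y<z x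
  ... | inj₁ y<x = contradiction y<x x≤y
  ... | inj₂ x<z = x<z

  ≤-respˡ : ∀ {x y z} → x ≈ y → x ≤ z → y ≤ z
  ≤-respˡ x≈y = ≤-trans (≤-reflexive (sym x≈y))

  ≤-respʳ : ∀ {x y z} → y ≈ z → x ≤ y → x ≤ z
  ≤-respʳ y≈z x≤y = ≤-trans x≤y (≤-reflexive y≈z)

  ≤-antisym : ∀ {x y} → x ≤ y → y ≤ x → x ≈ y
  ≤-antisym x≤y y≤x = proj₁ (R.tight _ _)
    ([ y≤x , x≤y ]′ ∘ Equivalence.to R.#⇔<⊎>)

  -- Since the order is defined by a negation, an inequality may be proved as
  -- if the order were total and decidable.
  ≤⇒¬¬<⊎≈ : ∀ {x y} → x ≤ y → ¬ ¬ (x < y ⊎ x ≈ y)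
  ≤⇒¬¬<⊎≈ x≤y k = k (inj₂ (≤-antisym x≤y (k ∘ inj₁)))

  x≤y⇒0≤y-x : ∀ {x y} → x ≤ y → 0# ≤ y - x
  x≤y⇒0≤y-x {x} {y} x≤y y-x<0 = x≤y
    (<-respˡ (solve 2 (λ x y → y :- x :+ x := y) refl x y)
      (<-respʳ (+-identityˡ x) (R.+-monoˡ-< x y-x<0)))

  0≤y-x⇒x≤y : ∀ {x y} → 0# ≤ y - x → x ≤ y
  0≤y-x⇒x≤y {x} {y} 0≤y-x y<x = 0≤y-x
    (<-respʳ (-‿inverseʳ x) (R.+-monoˡ-< (- x) y<x))

  +-nonneg : ∀ {x y} → 0# ≤ x → 0# ≤ y → 0# ≤ x + y
  +-nonneg {x} {y} 0≤x 0≤y x+y<0 = ≤⇒¬¬<⊎≈ 0≤y λ where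
    (inj₁ 0<y) → <⇒≤ (nonneg+pos 0≤x 0<y) x+y<0
    (inj₂ 0≈y) → 0≤x (<-respˡ (trans (+-congˡ (sym 0≈y)) (+-identityʳ x)) x+y<0)

  +-mono-≤ : ∀ {x y u v} → x ≤ y → u ≤ v → x + u ≤ y + v
  +-mono-≤ {x} {y} {u} {v} x≤y u≤v = 0≤y-x⇒x≤y
    (≤-respʳ (solve 4 (λ x y u v → (y :- x) :+ (v :- u) := (y :+ v) :- (x :+ u)) refl x y u v)
      (+-nonneg (x≤y⇒0≤y-x x≤y) (x≤y⇒0≤y-x u≤v)))

  +-mono-< : ∀ {x y u v} → x < y → u < v → x + u < y + v
  +-mono-< {x} {y} {u} {v} x<y u<v = <.trans (R.+-monoˡ-< u x<y)
    (<-respˡ (+-comm u y) (<-respʳ (+-comm v y) (R.+-monoˡ-< y u<v)))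

  +-pos : ∀ {x y} → 0# < x → 0# < y → 0# < x + y
  +-pos 0<x = nonneg+pos (<⇒≤ 0<x)

  -‿mono-≤ : ∀ {x y} → x ≤ y → - y ≤ - x
  -‿mono-≤ {x} {y} x≤y = 0≤y-x⇒x≤y
    (≤-respʳ (solve 2 (λ x y → y :- x := :- x :- :- y) refl x y) (x≤y⇒0≤y-x x≤y))

  *-nonneg : ∀ {x y} → 0# ≤ x → 0# ≤ y → 0# ≤ x * y
  *-nonneg {x} {y} 0≤x 0≤y xy<0 = ≤⇒¬¬<⊎≈ 0≤x λ where
    (inj₂ 0≈x) → <.irrefl (trans (*-congʳ (sym 0≈x)) (zeroˡ y)) xy<0
    (inj₁ 0<x) → ≤⇒¬¬<⊎≈ 0≤y λ where
      (inj₁ 0<y) → <⇒≤ (R.*-pos 0<x 0<y) xy<0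
      (inj₂ 0≈y) → <.irrefl (trans (*-congˡ (sym 0≈y)) (zeroʳ x)) xy<0

  *-mono-≤ : ∀ {x y u v} → 0# ≤ x → x ≤ y → 0# ≤ v → u ≤ v → x * u ≤ y * v
  *-mono-≤ {x} {y} {u} {v} 0≤x x≤y 0≤v u≤v = 0≤y-x⇒x≤y
    (≤-respʳ (solve 4 (λ x y u v → (y :- x) :* v :+ x :* (v :- u) := y :* v :- x :* u)
        refl x y u v)
      (+-nonneg (*-nonneg (x≤y⇒0≤y-x x≤y) 0≤v) (*-nonneg 0≤x (x≤y⇒0≤y-x u≤v))))

  *-monoˡ-≤ : ∀ {x u v} → 0# ≤ x → u ≤ v → x * u ≤ x * v
  *-monoˡ-≤ {x} {u} {v} 0≤x u≤v = 0≤y-x⇒x≤y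
    (≤-respʳ (solve 3 (λ x u v → x :* (v :- u) := x :* v :- x :* u) refl x u v)
      (*-nonneg 0≤x (x≤y⇒0≤y-x u≤v)))

  *-monoʳ-≤ : ∀ {x u v} → 0# ≤ x → u ≤ v → u * x ≤ v * x
  *-monoʳ-≤ 0≤x u≤v =
    ≤-respˡ (*-comm _ _) (≤-respʳ (*-comm _ _) (*-monoˡ-≤ 0≤x u≤v))

  *-monoˡ-< : ∀ {x u v} → 0# < x → u < v → x * u < x * v
  *-monoˡ-< {x} {u} {v} 0<x u<v = 0<y-x⇒x<y
    (<-respʳ (solve 3 (λ x u v → x :* (v :- u) := x :* v :- x :* u) refl x u v)
      (R.*-pos 0<x (x<y⇒0<y-x u<v)))

  square-cancel-≤ : ∀ {x y} → 0# ≤ y → x * x ≤ y * y → x ≤ y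
  square-cancel-≤ {x} {y} 0≤y xx≤yy y<x = xx≤yy (0<y-x⇒x<y
    (<-respʳ (solve 2 (λ x y → (x :- y) :* (y :+ x) := x :* x :- y :* y) refl x y)
      (R.*-pos (x<y⇒0<y-x y<x) (nonneg+pos 0≤y (≤-<-trans 0≤y y<x)))))

  square-< : ∀ {x y} → - y < x → x < y → x * x < y * y
  square-< {x} {y} -y<x x<y = 0<y-x⇒x<y
    (<-respʳ (solve 2 (λ x y → (x :- :- y) :* (y :- x) := y :* y :- x :* x) refl x y)
      (R.*-pos (x<y⇒0<y-x -y<x) (x<y⇒0<y-x x<y)))

  0≤1 : 0# ≤ 1#
  0≤1 = <⇒≤ 0<1

  -- A positive real has a positive reciprocal.
  inverse : ∀ {x} → 0# < x → ∃[ r ] 0# < r × x * r ≈ 1#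
  inverse {x} 0<x with R.#⇒invertible (Equivalence.from R.#⇔<⊎> (inj₂ 0<x))
  ... | r , r*x≈1 , x*r≈1 = r , 0<r , xr≈1
    where
    xr≈1 : x * r ≈ 1#
    xr≈1 = trans (solve 2 (λ x r → x :* r := (x :- con (+ 0)) :* r) refl x r) x*r≈1
    rx≈1 : (r - 0#) * x ≈ 1#
    rx≈1 = trans (solve 2 (λ x r → (r :- con (+ 0)) :* x := x :* r) refl x r) xr≈1
    0<r : 0# < r
    0<r with Equivalence.to R.#⇔<⊎> (R.invertible⇒# (x , trans (*-comm _ _) rx≈1 , rx≈1))
    ... | inj₂ 0<r = 0<r
    ... | inj₁ r<0 = contradiction
      (<-respʳ (solve 2 (λ x r → x :* :- r := :- (x :* r)) refl x r) (R.*-pos 0<x (x<0⇒0<-x r<0)))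
      (≤-respˡ (-‿cong (sym xr≈1))
        (≤-trans (-‿mono-≤ 0≤1) (≤-reflexive -0#≈0#)))
      where open import Algebra.Properties.Ring ring using (-0#≈0#)

  0<2 : 0# < 1# + 1#
  0<2 = +-pos 0<1 0<1

  ½ : Carrier
  ½ = proj₁ (inverse 0<2)

  0<½ : 0# < ½
  0<½ = proj₁ (proj₂ (inverse 0<2))

  2*½≈1 : (1# + 1#) * ½ ≈ 1#
  2*½≈1 = proj₂ (proj₂ (inverse 0<2))

  ½+½≈1 : ½ + ½ ≈ 1#
  ½+½≈1 = trans (solve 1 (λ h → h :+ h := con (+ 2) :* h) refl ½) 2*½≈1

  ½<1 : ½ < 1#
  ½<1 = <-respˡ (+-identityˡ ½) (<-respʳ ½+½≈1 (R.+-monoˡ-< ½ 0<½))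

  ^-nonneg : ∀ {x} n → 0# ≤ x → 0# ≤ x ^ n
  ^-nonneg zero    0≤x = 0≤1
  ^-nonneg (suc n) 0≤x = *-nonneg 0≤x (^-nonneg n 0≤x)

  ^-pos : ∀ {x} n → 0# < x → 0# < x ^ n
  ^-pos zero    0<x = 0<1
  ^-pos (suc n) 0<x = R.*-pos 0<x (^-pos n 0<x)

  ^-monoˡ-≤ : ∀ {x y} n → 0# ≤ x → x ≤ y → x ^ n ≤ y ^ n
  ^-monoˡ-≤ zero    0≤x x≤y = ≤-refl
  ^-monoˡ-≤ (suc n) 0≤x x≤y =
    *-mono-≤ 0≤x x≤y (^-nonneg n (≤-trans 0≤x x≤y)) (^-monoˡ-≤ n 0≤x x≤y)

  1^n≈1 : ∀ n → 1# ^ n ≈ 1#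
  1^n≈1 zero    = refl
  1^n≈1 (suc n) = trans (*-identityˡ _) (1^n≈1 n)

  ^-≤1 : ∀ {x} n → 0# ≤ x → x ≤ 1# → x ^ n ≤ 1#
  ^-≤1 n 0≤x x≤1 = ≤-respʳ (1^n≈1 n) (^-monoˡ-≤ n 0≤x x≤1)

  1≤^ : ∀ {x} n → 1# ≤ x → 1# ≤ x ^ n
  1≤^ n 1≤x = ≤-respˡ (1^n≈1 n) (^-monoˡ-≤ n 0≤1 1≤x)

  ^-antimonoʳ-≤ : ∀ {x m n} → 0# ≤ x → x ≤ 1# → m ℕ.≤ n → x ^ n ≤ x ^ m
  ^-antimonoʳ-≤ {x} {m} {n} 0≤x x≤1 m≤n =
    ≤-respˡ (trans (sym (^-homo-* x m (n ℕ.∸ m))) (reflexive (≡.cong (x ^_) (ℕ.m+[n∸m]≡n m≤n))))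
      (≤-respʳ (*-identityʳ _) (*-monoˡ-≤ (^-nonneg m 0≤x) (^-≤1 (n ℕ.∸ m) 0≤x x≤1)))

  ^-monoʳ-≤ : ∀ {x m n} → 1# ≤ x → m ℕ.≤ n → x ^ m ≤ x ^ n
  ^-monoʳ-≤ {x} {m} {n} 1≤x m≤n =
    ≤-respʳ (trans (sym (^-homo-* x m (n ℕ.∸ m))) (reflexive (≡.cong (x ^_) (ℕ.m+[n∸m]≡n m≤n))))
      (≤-respˡ (*-identityʳ _)
        (*-monoˡ-≤ (^-nonneg m (≤-trans 0≤1 1≤x)) (1≤^ (n ℕ.∸ m) 1≤x)))

  bernoulli : ∀ {u} n → 0# ≤ u → 1# + n · u ≤ (1# + u) ^ n
  bernoulli {u} zero    0≤u = ≤-reflexive (+-identityʳ 1#)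
  bernoulli {u} (suc n) 0≤u = ≤-trans
    (≤-respˡ (+-identityʳ _) (≤-respʳ
      (solve 2 (λ u x → con (+ 1) :+ (u :+ x) :+ u :* x :=
                        (con (+ 1) :+ u) :* (con (+ 1) :+ x)) refl u (n · u))
      (+-mono-≤ ≤-refl (*-nonneg 0≤u (·-nonneg n)))))
    (*-monoˡ-≤ (+-nonneg 0≤1 0≤u) (bernoulli n 0≤u))
    where
    ·-nonneg : ∀ n → 0# ≤ n · u
    ·-nonneg zero    = ≤-refl
    ·-nonneg (suc n) = +-nonneg 0≤u (·-nonneg n)

  -- The Archimedean property relative to an arbitrary positive unit y.
  archimedean : ∀ {y} x → 0# < y → ∃[ n ] x < n · y
  archimedean {y} x 0<y = n , <-respˡ yxr≈x (<-respʳ (sym (n·y≈y*n·1 n)) (*-monoˡ-< 0<y xr<n))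
    where
    r = proj₁ (inverse 0<y)
    n = proj₁ (R.archimedean (x * r))
    xr<n : x * r < n · 1#
    xr<n = proj₂ (R.archimedean (x * r))
    yxr≈x : y * (x * r) ≈ x
    yxr≈x = trans (solve 3 (λ x y r → y :* (x :* r) := x :* (y :* r)) refl x y r)
      (trans (*-congˡ (proj₂ (proj₂ (inverse 0<y)))) (*-identityʳ x))
    n·y≈y*n·1 : ∀ n → n · y ≈ y * n · 1#
    n·y≈y*n·1 zero    = sym (zeroʳ y)
    n·y≈y*n·1 (suc n) = trans (+-cong (sym (*-identityʳ y)) (n·y≈y*n·1 n)) (sym (distribˡ y _ _))

  powers-unbounded : ∀ {x} D → 1# < x → ∃[ n ] D ≤ x ^ n
  powers-unbounded {x} D 1<x = n ,
    ≤-respʳ (^-congˡ n (solve 1 (λ x → con (+ 1) :+ (x :- con (+ 1)) := x) refl x))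
      (≤-trans (≤-trans (<⇒≤ (proj₂ D<n[x-1]))
          (≤-respˡ (+-identityˡ _) (+-mono-≤ 0≤1 ≤-refl)))
        (bernoulli n (x≤y⇒0≤y-x (<⇒≤ 1<x))))
    where
    D<n[x-1] : ∃[ n ] D < n · (x - 1#)
    D<n[x-1] = archimedean D (x<y⇒0<y-x 1<x)
    n = proj₁ D<n[x-1]

  -- In this form (D arbitrary, bound 1) the lemma gives both convergence of
  -- geometric sequences to 0 and the choice of an exponent that beats D.
  powers-vanish : ∀ {t} D → 0# < t → t < 1# → ∃[ n ] t ^ n * D ≤ 1#
  powers-vanish {t} D 0<t t<1 = n ,
    ≤-respʳ (trans (sym (^-distrib-* t T n)) (trans (^-congˡ n tT≈1) (1^n≈1 n)))
      (*-monoˡ-≤ (^-nonneg n (<⇒≤ 0<t)) (proj₂ D≤T^n))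
    where
    T = proj₁ (inverse 0<t)
    0<T : 0# < T
    0<T = proj₁ (proj₂ (inverse 0<t))
    tT≈1 : t * T ≈ 1#
    tT≈1 = proj₂ (proj₂ (inverse 0<t))
    1<T : 1# < T
    1<T = <-respˡ (trans (*-comm T t) tT≈1) (<-respʳ (*-identityʳ T) (*-monoˡ-< 0<T t<1))
    D≤T^n : ∃[ n ] D ≤ T ^ n
    D≤T^n = powers-unbounded D 1<T
    n = proj₁ D≤T^n

-- Finite sets of indices and sums over them

-- A duplicate-free list contained in T splits off from T: the list R stands
-- for the difference of the two.
Unique-⊆⇒↭++ : ∀ {a} {A : Set a} {S T : List A} →
  Unique S → S ⊆ T → ∃[ R ] T ↭ S ++ R
Unique-⊆⇒↭++ {S = []}    {T} _          _   = T , ↭-refl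
Unique-⊆⇒↭++ {S = x ∷ S} {T} (x∉S ∷ uS) S⊆T with ∈-∃++ (S⊆T (here ≡.refl))
... | T₁ , T₂ , ≡.refl with Unique-⊆⇒↭++ {T = T₁ ++ T₂} uS S⊆T₁++T₂
  where
  S⊆T₁++T₂ : S ⊆ T₁ ++ T₂
  S⊆T₁++T₂ y∈S with ∈-resp-↭ (shift x T₁ T₂) (S⊆T (there y∈S))
  ... | here y≡x = contradiction (≡.sym y≡x) (All.lookup x∉S y∈S)
  ... | there y∈ = y∈
... | R , p = R , ↭-trans (shift x T₁ T₂) (prep x p)

-- The square [0 , n) × [0 , n).
box : ℕ → List (ℕ × ℕ)
box n = cartesianProduct (downFrom n) (downFrom n)

box-unique : ∀ n → Unique (box n)
box-unique n = Unique.cartesianProduct⁺ (Unique.downFrom⁺ n) (Unique.downFrom⁺ n)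

box-mono : ∀ {m n} → m ℕ.≤ n → box m ⊆ box n
box-mono m≤n x∈box with ∈-cartesianProduct⁻ (downFrom _) (downFrom _) x∈box
... | a∈ , b∈ = ∈-cartesianProduct⁺
  (∈-downFrom⁺ (ℕ.≤-trans (∈-downFrom⁻ a∈) m≤n)) (∈-downFrom⁺ (ℕ.≤-trans (∈-downFrom⁻ b∈) m≤n))

⊆-box : ∀ T → ∃[ n ] T ⊆ box n
⊆-box []            = 0 , λ ()
⊆-box ((a , b) ∷ T) = n , λ where
    (here ≡.refl) → ∈-cartesianProduct⁺
      (∈-downFrom⁺ (ℕ.≤-trans (ℕ.m≤m⊔n (suc a) (suc b)) (ℕ.m≤m⊔n _ m)))
      (∈-downFrom⁺ (ℕ.≤-trans (ℕ.m≤n⊔m (suc a) (suc b)) (ℕ.m≤m⊔n _ m)))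
    (there x∈T) → box-mono (ℕ.m≤n⊔m (suc a ℕ.⊔ suc b) m) (proj₂ (⊆-box T) x∈T)
  where
  m = proj₁ (⊆-box T)
  n = (suc a ℕ.⊔ suc b) ℕ.⊔ m

-- The translation (a , b) ↦ (a + 1 , b) and the preimage of a list under it.
translate : ℕ × ℕ → ℕ × ℕ
translate (a , b) = suc a , b

untranslate : List (ℕ × ℕ) → List (ℕ × ℕ)
untranslate []                = []
untranslate ((zero  , b) ∷ T) = untranslate T
untranslate ((suc a , b) ∷ T) = (a , b) ∷ untranslate T

untranslate-∈ : ∀ {x} T → translate x ∈ T → x ∈ untranslate T
untranslate-∈ ((zero  , b) ∷ T) (there x∈T)  = untranslate-∈ T x∈T
untranslate-∈ ((suc a , b) ∷ T) (here ≡.refl)  = here ≡.refl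
untranslate-∈ ((suc a , b) ∷ T) (there x∈T)  = there (untranslate-∈ T x∈T)

untranslate-unique : ∀ {T} → Unique T → Unique (untranslate T)
untranslate-unique {[]}              []         = []
untranslate-unique {(zero  , b) ∷ T} (_   ∷ uT) = untranslate-unique uT
untranslate-unique {(suc a , b) ∷ T} (x∉T ∷ uT) = fresh T x∉T ∷ untranslate-unique uT
  where
  fresh : ∀ T → All ((suc a , b) ≢_) T → All ((a , b) ≢_) (untranslate T)
  fresh []                []         = []
  fresh ((zero  , _) ∷ T) (_   ∷ ps) = fresh T ps
  fresh ((suc _ , _) ∷ T) (x≢y ∷ ps) = (λ eq → x≢y (≡.cong translate eq)) ∷ fresh T ps

-- The sum over a list of pairs; for the complex numbers it is the sum that
-- occurs in the definition of unconditional convergence.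
module FiniteSums {c ℓ} (R : CommutativeRing c ℓ) where

  open CommutativeRing R hiding (zero)
  open IntegerCoefficients R

  ∑ : List (ℕ × ℕ) → (ℕ → ℕ → Carrier) → Carrier
  ∑ T f = foldr _+_ 0# (map (uncurry f) T)

  ∑-cong : ∀ {f g} T → (∀ a b → f a b ≈ g a b) → ∑ T f ≈ ∑ T g
  ∑-cong []      f≈g = refl
  ∑-cong (x ∷ T) f≈g = +-cong (f≈g _ _) (∑-cong T f≈g)

  ∑-↭ : ∀ {S T} f → S ↭ T → ∑ S f ≈ ∑ T f
  ∑-↭ f p = Permutation.foldr-commMonoid setoid +-isCommutativeMonoid
    (↭⇒↭ₛ′ isEquivalence (↭-map⁺ (uncurry f) p))

  ∑-++ : ∀ S T f → ∑ (S ++ T) f ≈ ∑ S f + ∑ T f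
  ∑-++ []      T f = sym (+-identityˡ _)
  ∑-++ (x ∷ S) T f = trans (+-congˡ (∑-++ S T f)) (sym (+-assoc _ _ _))

  ∑-+ : ∀ T f g → ∑ T (λ a b → f a b + g a b) ≈ ∑ T f + ∑ T g
  ∑-+ []            f g = sym (+-identityˡ _)
  ∑-+ ((a , b) ∷ T) f g = trans (+-congˡ (∑-+ T f g))
    (solve 4 (λ x y u v → (x :+ y) :+ (u :+ v) := (x :+ u) :+ (y :+ v)) refl
      (f a b) (g a b) (∑ T f) (∑ T g))

  ∑-* : ∀ T k f → ∑ T (λ a b → k * f a b) ≈ k * ∑ T f
  ∑-* []      k f = sym (zeroʳ k)
  ∑-* (x ∷ T) k f = trans (+-congˡ (∑-* T k f)) (sym (distribˡ k _ _))

  ∑-untranslate : ∀ T f → (∀ b → f 0 b ≈ 0#) → ∑ T f ≈ ∑ (untranslate T) (λ a b → f (suc a) b)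
  ∑-untranslate []                f f0≈0 = refl
  ∑-untranslate ((zero  , b) ∷ T) f f0≈0 = trans (+-cong (f0≈0 b) (∑-untranslate T f f0≈0)) (+-identityˡ _)
  ∑-untranslate ((suc a , b) ∷ T) f f0≈0 = +-congˡ (∑-untranslate T f f0≈0)

  -- Sums over a list of single indices.
  ∑₁ : List ℕ → (ℕ → Carrier) → Carrier
  ∑₁ xs u = foldr _+_ 0# (map u xs)

  ∑-cartesianProduct : ∀ xs ys u v →
    ∑ (cartesianProduct xs ys) (λ a b → u a * v b) ≈ ∑₁ xs u * ∑₁ ys v
  ∑-cartesianProduct []       ys u v = sym (zeroˡ _)
  ∑-cartesianProduct (x ∷ xs) ys u v =
    trans (∑-++ (map (x ,_) ys) (cartesianProduct xs ys) (λ a b → u a * v b))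
      (trans (+-cong (row ys) (∑-cartesianProduct xs ys u v)) (sym (distribʳ _ _ _)))
    where
    row : ∀ ys → ∑ (map (x ,_) ys) (λ a b → u a * v b) ≈ u x * ∑₁ ys v
    row []       = sym (zeroʳ _)
    row (y ∷ ys) = trans (+-congˡ (row ys)) (sym (distribˡ _ _ _))

-- Dominated double series of real numbers
module RealSeries {c ℓ₁ ℓ₂} (ℛ : RealNumbers c ℓ₁ ℓ₂) where

  private
    module R = RealNumbers ℛ
    module < = IsStrictPartialOrder R.isStrictPartialOrder
  open CommutativeRing R.commutativeRing hiding (zero)
  open R using (_<_)
  open ComplexNumbers ℛ using (<-respˡ; <-respʳ)
  open import Algebra.Definitions.RawSemiring R.rawSemiring using (_^_)
  open IntegerCoefficients R.commutativeRing
  open FiniteSums R.commutativeRing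
  open RealOrder ℛ

  ∑-mono-≤ : ∀ {f g} T → (∀ a b → f a b ≤ g a b) → ∑ T f ≤ ∑ T g
  ∑-mono-≤ []      f≤g = ≤-refl
  ∑-mono-≤ (x ∷ T) f≤g = +-mono-≤ (f≤g _ _) (∑-mono-≤ T f≤g)

  ∑-nonneg : ∀ {f} T → (∀ a b → 0# ≤ f a b) → 0# ≤ ∑ T f
  ∑-nonneg []      0≤f = ≤-refl
  ∑-nonneg (x ∷ T) 0≤f = +-nonneg (0≤f _ _) (∑-nonneg T 0≤f)

  -- The summable family 2^-(a + b) that dominates all series considered.
  weight : ℕ → ℕ → Carrier
  weight a b = ½ ^ a * ½ ^ b

  weight-nonneg : ∀ a b → 0# ≤ weight a b
  weight-nonneg a b = *-nonneg (^-nonneg a (<⇒≤ 0<½)) (^-nonneg b (<⇒≤ 0<½))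

  geometric-sum : ∀ n → ∑₁ (downFrom n) (½ ^_) ≈ (1# + 1#) * (1# - ½ ^ n)
  geometric-sum zero    = solve 0 (con (+ 0) := con (+ 2) :* (con (+ 1) :- con (+ 1))) refl
  geometric-sum (suc n) = trans (+-congˡ (geometric-sum n))
    (trans (solve 1 (λ p → p :+ con (+ 2) :* (con (+ 1) :- p) := con (+ 2) :- con (+ 1) :* p)
        refl (½ ^ n))
      (trans (+-congˡ (-‿cong (*-congʳ (sym 2*½≈1))))
        (solve 2 (λ h p → con (+ 2) :- (con (+ 2) :* h) :* p := con (+ 2) :* (con (+ 1) :- h :* p))
          refl ½ (½ ^ n))))

  8# : Carrier
  8# = 1# + 1# + 1# + 1# + 1# + 1# + 1# + 1#

  -- The weights outside the box of side n have sum at most 8 / 2^n.  The list T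
  -- lies in a box of some side m, so the sum over R is at most the difference
  -- 4 (1 - 2^-m)² - 4 (1 - 2^-n)² of the sums over the two boxes.
  ∑-weight-tail : ∀ n {T R} → T ↭ box n ++ R → Unique T → ∑ R weight ≤ 8# * ½ ^ n
  ∑-weight-tail n {T} {R} T↭ uT = 0≤y-x⇒x≤y (≤-respʳ
      (trans (solve 3 (λ p r s →
          (con (+ 4) :- s) :+ r :+ con (+ 4) :* (p :* p) :=
          con (+ 8) :* p :-
            (s :- (con (+ 2) :* (con (+ 1) :- p)) :* (con (+ 2) :* (con (+ 1) :- p)) :- r))
          refl p (∑ R′ weight) (∑ (box m) weight))
        (+-congˡ (-‿cong (sym R≈))))
      (+-nonneg (+-nonneg (x≤y⇒0≤y-x box≤4) (∑-nonneg R′ weight-nonneg))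
        (*-nonneg 0≤4 (*-nonneg 0≤p 0≤p))))
    where
    m = proj₁ (⊆-box T)
    -- The indices of the larger box outside T.
    R′ = proj₁ (Unique-⊆⇒↭++ uT (proj₂ (⊆-box T)))
    p = ½ ^ n
    q = ½ ^ m
    0≤p : 0# ≤ p
    0≤p = ^-nonneg n (<⇒≤ 0<½)
    ∑-box : ∀ n → ∑ (box n) weight ≈
      ((1# + 1#) * (1# - ½ ^ n)) * ((1# + 1#) * (1# - ½ ^ n))
    ∑-box n = trans (∑-cartesianProduct (downFrom n) (downFrom n) (½ ^_) (½ ^_))
      (*-cong (geometric-sum n) (geometric-sum n))
    0≤4 : 0# ≤ 1# + 1# + 1# + 1#
    0≤4 = +-nonneg (+-nonneg (+-nonneg 0≤1 0≤1) 0≤1) 0≤1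
    0≤1-q : 0# ≤ 1# - q
    0≤1-q = x≤y⇒0≤y-x (^-≤1 m (<⇒≤ 0<½) (<⇒≤ ½<1))
    1-q≤1 : 1# - q ≤ 1#
    1-q≤1 = 0≤y-x⇒x≤y (≤-respʳ (solve 1 (λ q → q := con (+ 1) :- (con (+ 1) :- q)) refl q)
      (^-nonneg m (<⇒≤ 0<½)))
    box≤4 : ∑ (box m) weight ≤ 1# + 1# + 1# + 1#
    box≤4 = ≤-respˡ
      (trans (solve 1 (λ q → con (+ 4) :* ((con (+ 1) :- q) :* (con (+ 1) :- q)) :=
          (con (+ 2) :* (con (+ 1) :- q)) :* (con (+ 2) :* (con (+ 1) :- q))) refl q)
        (sym (∑-box m)))
      (≤-respʳ (solve 0 (con (+ 4) :* (con (+ 1) :* con (+ 1)) := con (+ 4)) refl)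
        (*-monoˡ-≤ 0≤4 (*-mono-≤ 0≤1-q 1-q≤1 0≤1 1-q≤1)))
    R≈ : ∑ R weight ≈ ∑ (box m) weight
      - ((1# + 1#) * (1# - p)) * ((1# + 1#) * (1# - p)) - ∑ R′ weight
    R≈ = trans (solve 3 (λ x y z → y := (x :+ y) :+ z :- x :- z) refl
          (∑ (box n) weight) (∑ R weight) (∑ R′ weight))
      (+-congʳ (+-cong
        (trans (+-congʳ (sym (trans (∑-↭ weight T↭) (∑-++ (box n) R weight))))
          (sym (trans (∑-↭ weight (proj₂ (Unique-⊆⇒↭++ uT (proj₂ (⊆-box T)))))
            (∑-++ T R′ weight))))
        (-‿cong (∑-box n))))

  ∣x+y∣< : ∀ {x y ε δ} → R.∣ x ∣< ε → R.∣ y ∣< δ → R.∣ x + y ∣< ε + δ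
  ∣x+y∣< {ε = ε} {δ} (l , r) (l′ , r′) =
    <-respˡ (solve 2 (λ x y → :- x :+ :- y := :- (x :+ y)) refl ε δ) (+-mono-< l l′) ,
    +-mono-< r r′

  -‿mono-< : ∀ {x y} → x < y → - y < - x
  -‿mono-< {x} {y} x<y = <-respˡ (solve 2 (λ x y → x :+ (:- x :- y) := :- y) refl x y)
    (<-respʳ (solve 2 (λ x y → y :+ (:- x :- y) := :- x) refl x y)
      (R.+-monoˡ-< (- x - y) x<y))

  ∣-x∣< : ∀ {x ε} → R.∣ x ∣< ε → R.∣ - x ∣< ε
  ∣-x∣< {x} {ε} (l , r) = -‿mono-< r ,
    <-respʳ (solve 1 (λ x → :- :- x := x) refl ε) (-‿mono-< l)

  ∣∣<-resp-≈ : ∀ {x y ε δ} → x ≈ y → ε ≈ δ → R.∣ x ∣< ε → R.∣ y ∣< δ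
  ∣∣<-resp-≈ x≈y ε≈δ (l , r) =
    <-respˡ (-‿cong ε≈δ) (<-respʳ x≈y l) , <-respˡ x≈y (<-respʳ ε≈δ r)

  ½ε+½ε≈ε : ∀ ε → ½ * ε + ½ * ε ≈ ε
  ½ε+½ε≈ε ε = trans (sym (distribʳ ε ½ ½)) (trans (*-congʳ ½+½≈1) (*-identityˡ ε))

  0<½ε : ∀ {ε} → 0# < ε → 0# < ½ * ε
  0<½ε = R.*-pos 0<½

  ½ε+½ε : ∀ {x y z ε} → x + y ≈ z → R.∣ x ∣< ½ * ε → R.∣ y ∣< ½ * ε → R.∣ z ∣< ε
  ½ε+½ε {ε = ε} x+y≈z ∣x∣< ∣y∣< = ∣∣<-resp-≈ x+y≈z (½ε+½ε≈ε ε) (∣x+y∣< ∣x∣< ∣y∣<)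

  geometric-tail-vanishes : ∀ K {ε} → 0# ≤ K → 0# < ε →
    ∃[ N ] ∀ n → N ℕ.≤ n → K * ½ ^ n < ε
  geometric-tail-vanishes K {ε} 0≤K 0<ε = N , λ n N≤n →
    ≤-<-trans (*-monoˡ-≤ 0≤K (^-antimonoʳ-≤ (<⇒≤ 0<½) (<⇒≤ ½<1) N≤n))
      (<-≤-trans (<-respˡ (+-identityʳ _) (<-respʳ refl K½^N<))
        (≤-respʳ (*-identityʳ ε) (*-monoˡ-≤ (<⇒≤ 0<ε) ½^ND≤1)))
    where
    r = proj₁ (inverse 0<ε)
    εr≈1 : ε * r ≈ 1#
    εr≈1 = proj₂ (proj₂ (inverse 0<ε))
    D = K * r + 1#
    N = proj₁ (powers-vanish D 0<½ ½<1)
    ½^ND≤1 : ½ ^ N * D ≤ 1#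
    ½^ND≤1 = proj₂ (powers-vanish D 0<½ ½<1)
    K½^N< : K * ½ ^ N + 0# < ε * (½ ^ N * D)
    K½^N< = <-respʳ
      (trans (+-congʳ (trans (sym (*-identityʳ _)) (*-congˡ (sym εr≈1))))
        (solve 4 (λ K p e r → (K :* p) :* (e :* r) :+ e :* p := e :* (p :* (K :* r :+ con (+ 1))))
          refl K (½ ^ N) ε r))
      (<-respˡ (+-comm 0# _) (<-respʳ (+-comm _ _)
        (R.+-monoˡ-< (K * ½ ^ N) (R.*-pos 0<ε (^-pos N 0<½)))))

  -- A family with |f a b| ≤ B / 2^(a + b) has an unconditional sum.
  module Dominated (f : ℕ → ℕ → Carrier) (B : Carrier) (0≤B : 0# ≤ B)
    (f≤ : ∀ a b → f a b ≤ B * weight a b) (-f≤ : ∀ a b → - (B * weight a b) ≤ f a b) where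

    -- The sum over the box of side n.
    partial : ℕ → Carrier
    partial n = ∑ (box n) f

    -- Sums over sets that contain a large box are close to the sum over the box.
    near-partial : ∀ n {ε T} → B * 8# * ½ ^ n < ε → Unique T → box n ⊆ T →
      R.∣ ∑ T f - partial n ∣< ε
    near-partial n {ε} {T} small uT box⊆T = ∣∣<-resp-≈ rest≈ refl
      ( <-≤-trans (-‿mono-< u<ε) (0≤y-x⇒x≤y (≤-respʳ
          (trans (∑-+ rest f u) (solve 2 (λ x y → x :+ y := x :- :- y) refl (∑ rest f) (∑ rest u)))
          (∑-nonneg rest λ a b → ≤-respʳ
            (solve 2 (λ x y → x :- :- y := x :+ y) refl (f a b) (u a b))
            (x≤y⇒0≤y-x (-f≤ a b)))))
      , ≤-<-trans (∑-mono-≤ rest f≤) u<ε )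
      where
      rest = proj₁ (Unique-⊆⇒↭++ (box-unique n) box⊆T)
      T↭ : T ↭ box n ++ rest
      T↭ = proj₂ (Unique-⊆⇒↭++ (box-unique n) box⊆T)
      u : ℕ → ℕ → Carrier
      u a b = B * weight a b
      u<ε : ∑ rest u < ε
      u<ε = ≤-<-trans (≤-respˡ (sym (∑-* rest B weight))
        (≤-respʳ (sym (*-assoc B 8# (½ ^ n))) (*-monoˡ-≤ 0≤B (∑-weight-tail n T↭ uT)))) small
      rest≈ : ∑ rest f ≈ ∑ T f - partial n
      rest≈ = trans (solve 2 (λ x y → y := (x :+ y) :- x) refl (partial n) (∑ rest f))
        (+-congʳ (sym (trans (∑-↭ f T↭) (∑-++ (box n) rest f))))

    0≤8B : 0# ≤ B * 8#
    0≤8B = *-nonneg 0≤B (+-nonneg (+-nonneg (+-nonneg (+-nonneg (+-nonneg (+-nonneg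
      (+-nonneg 0≤1 0≤1) 0≤1) 0≤1) 0≤1) 0≤1) 0≤1) 0≤1)

    partial-cauchy : R.IsCauchy partial
    partial-cauchy ε 0<ε = N , λ m n N≤m N≤n → ½ε+½ε
        (solve 3 (λ x y z → (x :- z) :+ :- (y :- z) := x :- y) refl
          (partial m) (partial n) (partial N))
        (near-partial N (small N ℕ.≤-refl) (box-unique m) (box-mono N≤m))
        (∣-x∣< (near-partial N (small N ℕ.≤-refl) (box-unique n) (box-mono N≤n)))
      where
      N = proj₁ (geometric-tail-vanishes (B * 8#) 0≤8B (0<½ε 0<ε))
      small : ∀ n → N ℕ.≤ n → B * 8# * ½ ^ n < ½ * ε
      small = proj₂ (geometric-tail-vanishes (B * 8#) 0≤8B (0<½ε 0<ε))

    total : Carrier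
    total = proj₁ (R.complete partial partial-cauchy)

    total-is-sum : ∀ ε → 0# < ε →
      ∃[ S ] ∀ T → Unique T → S ⊆ T → R.∣ ∑ T f - total ∣< ε
    total-is-sum ε 0<ε = box n , λ T uT box⊆T → ½ε+½ε
        (solve 3 (λ x y z → (x :- y) :+ (y :- z) := x :- z) refl (∑ T f) (partial n) total)
        (near-partial n (small n (ℕ.m≤m⊔n N M)) uT box⊆T)
        (close n (ℕ.m≤n⊔m N M))
      where
      N = proj₁ (geometric-tail-vanishes (B * 8#) 0≤8B (0<½ε 0<ε))
      small : ∀ n → N ℕ.≤ n → B * 8# * ½ ^ n < ½ * ε
      small = proj₂ (geometric-tail-vanishes (B * 8#) 0≤8B (0<½ε 0<ε))
      M = proj₁ (proj₂ (R.complete partial partial-cauchy) (½ * ε) (0<½ε 0<ε))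
      close : ∀ n → M ℕ.≤ n → R.∣ partial n - total ∣< ½ * ε
      close = proj₂ (proj₂ (R.complete partial partial-cauchy) (½ * ε) (0<½ε 0<ε))
      n = N ℕ.⊔ M

-- The real numbers together with the theory above, for qualified use.
module RealToolkit {c ℓ₁ ℓ₂} (ℛ : RealNumbers c ℓ₁ ℓ₂) where

  open RealNumbers ℛ public hiding (archimedean)
  open IntegerCoefficients (RealNumbers.commutativeRing ℛ) public
  open RealOrder ℛ public
  open RealSeries ℛ public
  open import Algebra.Definitions.RawSemiring (RealNumbers.rawSemiring ℛ) public using (_^_)
  open import Algebra.Properties.Semiring.Exp (RealNumbers.semiring ℛ) public
    using (^-homo-*; ^-congˡ; ^-assocʳ)
  open import Algebra.Properties.CommutativeSemiring.Exp
    (CommutativeRing.commutativeSemiring (RealNumbers.commutativeRing ℛ)) public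
    using (^-distrib-*)

-- Unconditional summation of complex double series
module ComplexSeries {c ℓ₁ ℓ₂} (ℛ : RealNumbers c ℓ₁ ℓ₂) where

  private
    module R = RealToolkit ℛ
    module ℝΣ = FiniteSums R.commutativeRing
    module < = IsStrictPartialOrder R.isStrictPartialOrder
  open R using (_≤_; ½)
  open ComplexNumbers ℛ
  open CommutativeRing commutativeRing
    using (refl; sym; trans; +-cong; +-congˡ; +-congʳ; +-identityˡ; +-identityʳ; -‿inverseʳ)
  open IntegerCoefficients commutativeRing
  open FiniteSums commutativeRing hiding (∑)

  ∣∣²-cong : ∀ {z w} → z ≈ w → ∣ z ∣² R.≈ ∣ w ∣²
  ∣∣²-cong (p , q) = R.+-cong (R.*-cong p p) (R.*-cong q q)

  square-nonneg : ∀ x → R.0# ≤ x R.* x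
  square-nonneg = square≮0

  ∣∣²-nonneg : ∀ z → R.0# ≤ ∣ z ∣²
  ∣∣²-nonneg z = R.+-nonneg (square-nonneg (re z)) (square-nonneg (im z))

  re²≤∣∣² : ∀ z → re z R.* re z ≤ ∣ z ∣²
  re²≤∣∣² z = R.≤-respˡ (R.+-identityʳ _) (R.+-mono-≤ R.≤-refl (square-nonneg (im z)))

  im²≤∣∣² : ∀ z → im z R.* im z ≤ ∣ z ∣²
  im²≤∣∣² z = R.≤-respˡ (R.+-identityˡ _) (R.+-mono-≤ (square-nonneg (re z)) R.≤-refl)

  -- The parallelogram inequality |z + w|² ≤ 2 (|z|² + |w|²).
  ∣z+w∣²≤ : ∀ z w → ∣ z + w ∣² ≤ (1ᵣ R.+ 1ᵣ) R.* (∣ z ∣² R.+ ∣ w ∣²)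
  ∣z+w∣²≤ z w = R.0≤y-x⇒x≤y (R.≤-respʳ
    (R.solve 4 (λ a b d e →
        (a R.:- d) R.:* (a R.:- d) R.:+ (b R.:- e) R.:* (b R.:- e) R.:=
        R.con (+ 2) R.:* ((a R.:* a R.:+ b R.:* b) R.:+ (d R.:* d R.:+ e R.:* e)) R.:-
          ((a R.:+ d) R.:* (a R.:+ d) R.:+ (b R.:+ e) R.:* (b R.:+ e)))
      R.refl (re z) (im z) (re w) (im w))
    (∣∣²-nonneg (z - w)))

  ∣∣<-resp-≈ : ∀ {z w ε} → z ≈ w → ∣ z ∣< ε → ∣ w ∣< ε
  ∣∣<-resp-≈ z≈w (0<ε , p) = 0<ε , <-respˡ (∣∣²-cong z≈w) p

  ½ε+½ε : ∀ {x y z ε} → x + y ≈ z → ∣ x ∣< ½ R.* ε → ∣ y ∣< ½ R.* ε → ∣ z ∣< ε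
  ½ε+½ε {x} {y} {z} {ε} x+y≈z (0<½ε , p) (_ , q) = ∣∣<-resp-≈ x+y≈z
    ( <-respʳ (R.½ε+½ε≈ε ε) (R.+-pos 0<½ε 0<½ε)
    , R.≤-<-trans (∣z+w∣²≤ x y) (<-respʳ
        (R.trans (R.solve 2 (λ h e →
            R.con (+ 2) R.:* ((h R.:* e) R.:* (h R.:* e) R.:+ (h R.:* e) R.:* (h R.:* e)) R.:=
            (h R.:* e R.:+ h R.:* e) R.:* (h R.:* e R.:+ h R.:* e)) R.refl ½ ε)
          (R.*-cong (R.½ε+½ε≈ε ε) (R.½ε+½ε≈ε ε)))
        (R.*-monoˡ-< R.0<2 (R.+-mono-< p q))))

  -- With both components below ε / 2 the squared modulus is below ε² / 2.
  from-components : ∀ {z ε} → R.∣ re z ∣< ½ R.* ε → R.∣ im z ∣< ½ R.* ε → 0ᵣ <ᵣ ε → ∣ z ∣< ε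
  from-components {z} {ε} (l , r) (l′ , r′) 0<ε = 0<ε ,
    <.trans (R.+-mono-< (R.square-< l r) (R.square-< l′ r′))
      (<-respˡ (R.sym split) (<-respʳ (R.*-identityʳ _) (R.*-monoˡ-< (R.*-pos 0<ε 0<ε) R.½<1)))
    where
    split : (½ R.* ε) R.* (½ R.* ε) R.+ (½ R.* ε) R.* (½ R.* ε) R.≈ (ε R.* ε) R.* ½
    split = R.trans (R.solve 2 (λ h e →
          (h R.:* e) R.:* (h R.:* e) R.:+ (h R.:* e) R.:* (h R.:* e) R.:=
          (e R.:* e) R.:* (h R.:* (R.con (+ 2) R.:* h))) R.refl ½ ε)
        (R.*-cong R.refl (R.trans (R.*-cong R.refl R.2*½≈1) (R.*-identityʳ ½)))

  re-∑ : ∀ T f → re (∑ T f) ≡ ℝΣ.∑ T (λ a b → re (f a b))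
  re-∑ []      f = ≡.refl
  re-∑ (x ∷ T) f = ≡.cong (R._+_ _) (re-∑ T f)

  im-∑ : ∀ T f → im (∑ T f) ≡ ℝΣ.∑ T (λ a b → im (f a b))
  im-∑ []      f = ≡.refl
  im-∑ (x ∷ T) f = ≡.cong (R._+_ _) (im-∑ T f)

  -- The hypothesis is |f a b| ≤ B / 2^(a + b), stated on squares; it passes to
  -- the real and imaginary parts.
  dominated⇒summable : ∀ {f} B → R.0# ≤ B →
    (∀ a b → ∣ f a b ∣² ≤ (B R.* R.weight a b) R.* (B R.* R.weight a b)) → Summable f
  dominated⇒summable {f} B 0≤B f≤ = (Re.total +i Im.total) , λ ε 0<ε →
      let S  , near  = Re.total-is-sum (½ R.* ε) (R.0<½ε 0<ε)
          S′ , near′ = Im.total-is-sum (½ R.* ε) (R.0<½ε 0<ε)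
      in S ++ S′ , λ T uT S⊆T → from-components
        (≡.subst (λ x → R.∣ x R.- Re.total ∣< _) (≡.sym (re-∑ T f))
          (near T uT (λ x∈S → S⊆T (∈-++⁺ˡ x∈S))))
        (≡.subst (λ x → R.∣ x R.- Im.total ∣< _) (≡.sym (im-∑ T f))
          (near′ T uT (λ x∈S → S⊆T (∈-++⁺ʳ S x∈S))))
        0<ε
    where
    0≤Bw : ∀ a b → R.0# ≤ B R.* R.weight a b
    0≤Bw a b = R.*-nonneg 0≤B (R.weight-nonneg a b)
    lower : ∀ {x y} → 0ᵣ ≤ y → x R.* x ≤ y R.* y → R.- y ≤ x
    lower {x} {y} 0≤y xx≤yy = R.≤-respʳ (R.solve 1 (λ x → R.:- R.:- x R.:= x) R.refl x)
      (R.-‿mono-≤ (R.square-cancel-≤ 0≤y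
        (R.≤-respˡ (R.solve 1 (λ x → x R.:* x R.:= (R.:- x) R.:* (R.:- x)) R.refl x) xx≤yy)))
    module Re = R.Dominated (λ a b → re (f a b)) B 0≤B
      (λ a b → R.square-cancel-≤ (0≤Bw a b) (R.≤-trans (re²≤∣∣² _) (f≤ a b)))
      (λ a b → lower (0≤Bw a b) (R.≤-trans (re²≤∣∣² _) (f≤ a b)))
    module Im = R.Dominated (λ a b → im (f a b)) B 0≤B
      (λ a b → R.square-cancel-≤ (0≤Bw a b) (R.≤-trans (im²≤∣∣² _) (f≤ a b)))
      (λ a b → lower (0≤Bw a b) (R.≤-trans (im²≤∣∣² _) (f≤ a b)))

  HasSum-cong : ∀ {f g s} → (∀ a b → f a b ≈ g a b) → f HasSum s → g HasSum s
  HasSum-cong {f} {g} {s} f≈g sum ε 0<ε = proj₁ (sum ε 0<ε) , λ T uT S⊆T →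
    ∣∣<-resp-≈ (+-congʳ {x = - s} (∑-cong {f} {g} T f≈g)) (proj₂ (sum ε 0<ε) T uT S⊆T)

  HasSum-+ : ∀ {f g s t} → f HasSum s → g HasSum t → (λ a b → f a b + g a b) HasSum (s + t)
  HasSum-+ {f} {g} {s} {t} sum sum′ ε 0<ε = S ++ S′ , λ T uT S⊆T → ½ε+½ε
      (trans (solve 4 (λ x y s t → (x :- s) :+ (y :- t) := (x :+ y) :- (s :+ t)) refl
          (∑ T f) (∑ T g) s t)
        (+-congʳ {x = - (s + t)} (sym (∑-+ T f g))))
      (near T uT (λ x∈S → S⊆T (∈-++⁺ˡ x∈S))) (near′ T uT (λ x∈S → S⊆T (∈-++⁺ʳ S x∈S)))
    where
    S  = proj₁ (sum (½ R.* ε) (R.0<½ε 0<ε))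
    S′ = proj₁ (sum′ (½ R.* ε) (R.0<½ε 0<ε))
    near = proj₂ (sum (½ R.* ε) (R.0<½ε 0<ε))
    near′ = proj₂ (sum′ (½ R.* ε) (R.0<½ε 0<ε))

  HasSum-* : ∀ {f s} k → f HasSum s → (λ a b → k * f a b) HasSum (k * s)
  HasSum-* {f} {s} k sum ε 0<ε = S , λ T uT S⊆T → 0<ε ,
      R.≤-<-trans (bound T) (<-respʳ scaled
        (R.*-monoˡ-< (R.*-pos 0<K 0<K) (proj₂ (near T uT S⊆T))))
    where
    -- A bound for |k| obtained without a square root: |k|² ≤ K ≤ K².
    K = 1ᵣ R.+ ∣ k ∣²
    1≤K : 1ᵣ ≤ K
    1≤K = R.≤-respˡ (R.+-identityʳ 1ᵣ) (R.+-mono-≤ R.≤-refl (∣∣²-nonneg k))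
    0<K : 0ᵣ <ᵣ K
    0<K = R.<-≤-trans 0<1 1≤K
    r = proj₁ (R.inverse 0<K)
    0<rε : 0ᵣ <ᵣ r R.* ε
    0<rε = R.*-pos (proj₁ (proj₂ (R.inverse 0<K))) 0<ε
    S = proj₁ (sum (r R.* ε) 0<rε)
    near = proj₂ (sum (r R.* ε) 0<rε)
    ∣k∣²≤KK : ∣ k ∣² ≤ K R.* K
    ∣k∣²≤KK = R.≤-trans (R.≤-respˡ (R.+-identityˡ _) (R.+-mono-≤ R.0≤1 R.≤-refl))
      (R.≤-respˡ (R.*-identityʳ K) (R.*-monoˡ-≤ (R.<⇒≤ 0<K) 1≤K))
    bound : ∀ T → ∣ ∑ T (λ a b → k * f a b) - k * s ∣² ≤ (K R.* K) R.* ∣ ∑ T f - s ∣²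
    bound T = R.≤-respˡ
      (R.trans (R.sym (∣zw∣² k (∑ T f - s))) (∣∣²-cong
        (trans (solve 3 (λ k x s → k :* (x :- s) := k :* x :- k :* s) refl k (∑ T f) s)
          (+-congʳ {x = - (k * s)} (sym (∑-* T k f))))))
      (R.*-monoʳ-≤ (∣∣²-nonneg (∑ T f - s)) ∣k∣²≤KK)
    scaled : (K R.* K) R.* ((r R.* ε) R.* (r R.* ε)) R.≈ ε R.* ε
    scaled = R.trans (R.solve 3 (λ K r e →
        (K R.:* K) R.:* ((r R.:* e) R.:* (r R.:* e)) R.:=
        ((K R.:* r) R.:* e) R.:* ((K R.:* r) R.:* e)) R.refl K r ε)
      (R.*-cong Krε≈ε Krε≈ε)
      where
      Krε≈ε : (K R.* r) R.* ε R.≈ ε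
      Krε≈ε = R.trans (R.*-cong (proj₂ (proj₂ (R.inverse 0<K))) R.refl) (R.*-identityˡ ε)

  -- The family f moved by the translation (a , b) ↦ (a + 1 , b), with value 0
  -- at the indices (0 , b).
  delay : (ℕ → ℕ → ℂ) → ℕ → ℕ → ℂ
  delay f zero    b = 0ᶜ
  delay f (suc a) b = f a b

  HasSum-delay : ∀ {f s} → f HasSum s → delay f HasSum s
  HasSum-delay {f} {s} sum ε 0<ε = map translate S , λ T uT S⊆T →
      ∣∣<-resp-≈ (+-congʳ {x = - s} (sym (∑-untranslate T (delay f) (λ _ → refl))))
        (near (untranslate T) (untranslate-unique uT)
          (λ x∈S → untranslate-∈ T (S⊆T (∈-map⁺ translate x∈S))))
    where
    S = proj₁ (sum ε 0<ε)
    near = proj₂ (sum ε 0<ε)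

  -- The family with value 1 at (0 , 0) and 0 elsewhere.
  δ₀ : ℕ → ℕ → ℂ
  δ₀ zero    zero    = 1ᶜ
  δ₀ zero    (suc b) = 0ᶜ
  δ₀ (suc a) b       = 0ᶜ

  HasSum-δ₀ : δ₀ HasSum 1ᶜ
  HasSum-δ₀ ε 0<ε = (0 , 0) ∷ [] , λ T uT S⊆T → 0<ε ,
      <-respˡ (R.trans zero² (∣∣²-cong {0ᶜ} (trans (sym (-‿inverseʳ 1ᶜ))
        (+-congʳ {x = - 1ᶜ} (sym (one T uT (S⊆T (here ≡.refl))))))))
        (R.*-pos 0<ε 0<ε)
    where
    zero² : R.0# R.≈ ∣ 0ᶜ ∣²
    zero² = R.solve 0 (R.con (+ 0) R.:= R.con (+ 0) R.:* R.con (+ 0) R.:+ R.con (+ 0) R.:* R.con (+ 0)) R.refl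
    none : ∀ T → All ((0 , 0) ≢_) T → ∑ T δ₀ ≈ 0ᶜ
    none []                    []         = refl
    none ((zero  , zero)  ∷ T) (0≢0 ∷ _) = contradiction ≡.refl 0≢0
    none ((zero  , suc _) ∷ T) (_ ∷ ps)   = trans (+-identityˡ _) (none T ps)
    none ((suc _ , _)     ∷ T) (_ ∷ ps)   = trans (+-identityˡ _) (none T ps)
    one : ∀ T → Unique T → (0 , 0) ∈ T → ∑ T δ₀ ≈ 1ᶜ
    one (_ ∷ T)               (∉T ∷ _) (here ≡.refl) = trans (+-congˡ {x = 1ᶜ} (none T ∉T)) (+-identityʳ 1ᶜ)
    one ((zero  , zero)  ∷ T) (∉T ∷ _)  (there 0∈T) = contradiction ≡.refl (All.lookup ∉T 0∈T)
    one ((zero  , suc _) ∷ T) (_ ∷ uT)  (there 0∈T) = trans (+-identityˡ _) (one T uT 0∈T)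
    one ((suc _ , _)     ∷ T) (_ ∷ uT)  (there 0∈T) = trans (+-identityˡ _) (one T uT 0∈T)

  infinitesimal⇒≈0 : ∀ {z} → (∀ ε → 0ᵣ <ᵣ ε → ∣ z ∣< ε) → z ≈ 0ᶜ
  infinitesimal⇒≈0 {z} small = vanishes (re²≤∣∣² z) , vanishes (im²≤∣∣² z)
    where
    vanishes : ∀ {x} → x R.* x ≤ ∣ z ∣² → x R.≈ 0ᵣ
    vanishes {x} xx≤ = R.≤-antisym
      (λ 0<x → xx≤ (proj₂ (small x 0<x)))
      (λ x<0 → R.≤-respˡ (R.solve 1 (λ x → x R.:* x R.:= (R.:- x) R.:* (R.:- x)) R.refl x) xx≤
        (proj₂ (small (R.- x) (x<0⇒0<-x x<0))))

  HasSum-unique : ∀ {f s t} → f HasSum s → f HasSum t → s ≈ t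
  HasSum-unique {f} {s} {t} sum sum′ =
    trans (solve 2 (λ s t → s := (s :- t) :+ t) refl s t)
      (trans (+-congʳ {x = t} (infinitesimal⇒≈0 close)) (+-identityˡ t))
    where
    close : ∀ ε → 0ᵣ <ᵣ ε → ∣ s - t ∣< ε
    close ε 0<ε = ½ε+½ε
        (solve 3 (λ x s t → :- (x :- s) :+ (x :- t) := s :- t) refl (∑ T f) s t)
        (proj₁ s-near , <-respˡ (R.solve 2 (λ x y → x R.:* x R.:+ y R.:* y R.:=
            (R.:- x) R.:* (R.:- x) R.:+ (R.:- y) R.:* (R.:- y)) R.refl
            (re (∑ T f - s)) (im (∑ T f - s)))
          (proj₂ s-near))
        t-near
      where
      S  = proj₁ (sum (½ R.* ε) (R.0<½ε 0<ε))
      S′ = proj₁ (sum′ (½ R.* ε) (R.0<½ε 0<ε))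
      n  = proj₁ (⊆-box (S ++ S′))
      T  = box n
      s-near : ∣ ∑ T f - s ∣< ½ R.* ε
      s-near = proj₂ (sum (½ R.* ε) (R.0<½ε 0<ε)) T (box-unique n)
        (λ x∈S → proj₂ (⊆-box (S ++ S′)) (∈-++⁺ˡ x∈S))
      t-near : ∣ ∑ T f - t ∣< ½ R.* ε
      t-near = proj₂ (sum′ (½ R.* ε) (R.0<½ε 0<ε)) T (box-unique n)
        (λ x∈S → proj₂ (⊆-box (S ++ S′)) (∈-++⁺ʳ S x∈S))

-- The series of the theorem
module QSeries {c ℓ₁ ℓ₂} (ℛ : RealNumbers c ℓ₁ ℓ₂)
  (q : ComplexNumbers.ℂ ℛ)
  (0<∣q∣ : ComplexNumbers.0<∣_∣ ℛ q)
  (∣q∣<1 : ComplexNumbers.∣_∣<_ ℛ q (RealNumbers.1# ℛ)) where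

  private
    module R = RealToolkit ℛ
    module ℤ-Solver = +-*-Solver
  open R using (_≤_; ½)
  open ComplexNumbers ℛ
  open CommutativeRing commutativeRing
    using (refl; sym; trans; reflexive; +-cong; +-congˡ; +-congʳ; *-cong; *-congˡ; *-congʳ; -‿cong;
      *-identityˡ; *-identityʳ; *-assoc; *-comm; zeroʳ; semiring; +-identityˡ; +-identityʳ)
  open import Algebra.Properties.Semiring.Exp semiring using (^-homo-*)
  open IntegerCoefficients commutativeRing
  open ComplexSeries ℛ
  open DoubleSeries ℛ q 0<∣q∣ ∣q∣<1
  -- Notation for polynomials with integer coefficients in integer variables.
  open ℤ-Solver using ()
    renaming (_:+_ to _⊕_; _:*_ to _⊛_; _:-_ to _⊖_; con to #; _:=_ to _⊜_)

  -- Division by nonzero complex numbers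

  z*z⁻¹≈1 : ∀ z (0<z : 0<∣ z ∣) → z * z ⁻¹[ 0<z ] ≈ 1ᶜ
  z*z⁻¹≈1 z 0<z =
    R.trans (R.solve 3 (λ x y r → x R.:* (x R.:* r) R.:- y R.:* ((R.:- y) R.:* r) R.:=
        r R.:* ((x R.:* x R.:+ y R.:* y) R.:- R.con (+ 0))) R.refl (re z) (im z) r)
      (proj₁ (proj₂ invertible)) ,
    R.solve 3 (λ x y r → x R.:* ((R.:- y) R.:* r) R.:+ y R.:* (x R.:* r) R.:= R.con (+ 0))
      R.refl (re z) (im z) r
    where
    invertible = R.#⇒invertible (Equivalence.from R.#⇔<⊎> (inj₂ 0<z))
    r = proj₁ invertible

  *-cancelʳ : ∀ {x y} z → 0<∣ z ∣ → x * z ≈ y * z → x ≈ y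
  *-cancelʳ {x} {y} z 0<z xz≈yz = trans (sym (cancel x)) (trans (*-congʳ {x = z ⁻¹[ 0<z ]} xz≈yz) (cancel y))
    where
    cancel : ∀ x → x * z * z ⁻¹[ 0<z ] ≈ x
    cancel x = trans (*-assoc x z _) (trans (*-congˡ {x = x} (z*z⁻¹≈1 z 0<z)) (*-identityʳ x))

  /-* : ∀ w {z} (0<z : 0<∣ z ∣) → w / z [ 0<z ] * z ≈ w
  /-* w {z} 0<z = trans (*-assoc w _ z)
    (trans (*-congˡ {x = w} (trans (*-comm _ z) (z*z⁻¹≈1 z 0<z))) (*-identityʳ w))

  -- Gaussian binomials

  -- The q-factorial (q; q)_n, without the usual division by (1 - q)^n.
  [_]! : ℕ → ℂ
  [ n ]! = (q ⨾ q) n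

  0<∣[_]![_]!∣ : ∀ m n → 0<∣ [ m ]! * [ n ]! ∣
  0<∣[ m ]![ n ]!∣ = 0<∣zw∣ (0<∣⨾∣ 0<∣q∣ ∣q∣<1 m) (0<∣⨾∣ 0<∣q∣ ∣q∣<1 n)

  if-true : ∀ {a} {A : Set a} {x y : A} b → Bool.T b → (if b then x else y) ≡ x
  if-true true _ = ≡.refl

  if-false : ∀ {a} {A : Set a} {x y : A} b → ¬ Bool.T b → (if b then x else y) ≡ y
  if-false true  ¬b = contradiction _ ¬b
  if-false false _  = ≡.refl

  -- The Gaussian binomial with natural indices.  It is opaque because its
  -- definition contains the proof that the denominator is nonzero, which is
  -- large when unfolded; it is used only through the facts of this block.
  opaque
    binom : ℕ → ℕ → ℂ
    binom k l = gauss (+ k) (+ l)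

    binom≡gauss : ∀ k l → binom k l ≡ gauss (+ k) (+ l)
    binom≡gauss k l = ≡.refl

    binom-zero : ∀ {k l} → k ℕ.< l → binom k l ≡ 0ᶜ
    binom-zero {k} {l} k<l = if-false (l ℕ.≤ᵇ k) (λ p → ℕ.<⇒≱ k<l (ℕ.≤ᵇ⇒≤ l k p))

    binom-quotient : ∀ {k l} → l ℕ.≤ k →
      binom k l ≡ [ k ]! / [ l ]! * [ k ℕ.∸ l ]! [ 0<∣[ l ]![ k ℕ.∸ l ]!∣ ]
    binom-quotient {k} {l} l≤k = if-true (l ℕ.≤ᵇ k) (ℕ.≤⇒≤ᵇ l≤k)

    binom-* : ∀ {k l} → l ℕ.≤ k → binom k l * ([ l ]! * [ k ℕ.∸ l ]!) ≈ [ k ]!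
    binom-* {k} {l} l≤k = trans
      (*-congʳ {x = [ l ]! * [ k ℕ.∸ l ]!} (reflexive (binom-quotient l≤k)))
      (/-* [ k ]! 0<∣[ l ]![ k ℕ.∸ l ]!∣)

  -- The defining equation [ k , l ] (q; q)_l (q; q)_(k-l) = (q; q)_k determines
  -- the binomial.
  binom-unique : ∀ {x k l} → l ℕ.≤ k → x * ([ l ]! * [ k ℕ.∸ l ]!) ≈ [ k ]! → binom k l ≈ x
  binom-unique {x} {k} {l} l≤k eq = *-cancelʳ {y = x} ([ l ]! * [ k ℕ.∸ l ]!) 0<∣[ l ]![ k ℕ.∸ l ]!∣
    (trans (binom-* l≤k) (sym eq))

  binom-0 : ∀ k → binom k 0 ≈ 1ᶜ
  binom-0 k = binom-unique ℕ.z≤n (trans (*-identityˡ _) (*-identityˡ [ k ]!))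

  binom-diagonal : ∀ k → binom k k ≈ 1ᶜ
  binom-diagonal k = binom-unique ℕ.≤-refl (trans (*-identityˡ _)
    (trans (*-congˡ {x = [ k ]!} (reflexive (≡.cong [_]! (ℕ.n∸n≡0 k)))) (*-identityʳ [ k ]!)))

  -- The truncated difference k ∸ l is harmless: for k < l its power of q is
  -- multiplied by 0.
  binom-pascal : ∀ k l → binom (suc k) (suc l) ≈ binom k (suc l) + q ^ (k ℕ.∸ l) * binom k l
  binom-pascal k l = by-cases (ℕ.<-cmp l k)
    where
    -- The case l < k with denominators cleared; it comes down to
    -- (1 - q^(j+1)) + q^(j+1) (1 - q^(l+1)) = 1 - q^(l+j+2).
    factorials : ∀ {k l j n x y} → n ≡ suc j → k ≡ l ℕ.+ suc j →
      x * ([ suc l ]! * [ j ]!) ≈ [ k ]! → y * ([ l ]! * [ n ]!) ≈ [ k ]! →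
      (x + q ^ n * y) * ([ suc l ]! * [ n ]!) ≈ [ suc k ]!
    factorials {k} {l} {j} {n} {x} {y} ≡.refl ≡.refl eq₁ eq₂ = trans
      (solve 7 (λ x y L J a b q →
          (x :+ (q :* b) :* y) :* ((L :* (con (+ 1) :- a :* q)) :* (J :* (con (+ 1) :- b :* q))) :=
          (x :* ((L :* (con (+ 1) :- a :* q)) :* J)) :* (con (+ 1) :- b :* q) :+
          (y :* (L :* (J :* (con (+ 1) :- b :* q)))) :* ((q :* b) :* (con (+ 1) :- a :* q)))
        refl x y [ l ]! [ j ]! (q ^ l) (q ^ j) q)
      (trans (+-cong (*-congʳ {x = 1ᶜ - q ^ j * q} eq₁)
          (*-congʳ {x = (q * q ^ j) * (1ᶜ - q ^ l * q)} eq₂))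
        (trans (solve 4 (λ K a b q →
            K :* (con (+ 1) :- b :* q) :+ K :* ((q :* b) :* (con (+ 1) :- a :* q)) :=
            K :* (con (+ 1) :- (a :* (q :* b)) :* q)) refl [ k ]! (q ^ l) (q ^ j) q)
          (*-congˡ {x = [ k ]!} (+-congˡ {x = 1ᶜ} (-‿cong
            (*-congʳ {x = q} (sym (^-homo-* q l (suc j)))))))))
    by-cases : Tri (l ℕ.< k) (l ≡ k) (k ℕ.< l) →
      binom (suc k) (suc l) ≈ binom k (suc l) + q ^ (k ℕ.∸ l) * binom k l
    by-cases (tri> _ _ k<l) = trans (reflexive (binom-zero (ℕ.s≤s k<l)))
      (sym (trans (+-cong (reflexive (binom-zero (ℕ.m<n⇒m<1+n k<l)))
          (*-congˡ {x = q ^ (k ℕ.∸ l)} (reflexive (binom-zero k<l))))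
        (trans (+-identityˡ _) (zeroʳ _))))
    by-cases (tri≈ _ ≡.refl _) = trans (binom-diagonal (suc k))
      (sym (trans (+-cong (reflexive (binom-zero (ℕ.n<1+n k)))
          (*-cong (reflexive (≡.cong (q ^_) (ℕ.n∸n≡0 k))) (binom-diagonal k)))
        (trans (+-identityˡ _) (*-identityˡ 1ᶜ))))
    by-cases (tri< l<k _ _) = binom-unique (ℕ.s≤s (ℕ.<⇒≤ l<k))
      (factorials {k} {l} {k ℕ.∸ suc l} (ℕ.+-∸-assoc 1 l<k)
        (≡.sym (≡.trans (ℕ.+-suc l (k ℕ.∸ suc l)) (ℕ.m+[n∸m]≡n l<k)))
        (binom-* l<k) (binom-* (ℕ.<⇒≤ l<k)))

  -- Integral powers of q

  q^-suc : ∀ i → q^ (i ℤ.+ + 1) ≈ q^ i * q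
  q^-suc (+ n)        = trans (reflexive (≡.cong (q ^_) (ℕ.+-comm n 1))) (*-comm q (q ^ n))
  q^-suc -[1+ zero ]  = sym (trans (*-congʳ {x = q} (*-identityʳ (q ⁻¹[ 0<∣q∣ ])))
    (trans (*-comm _ q) (z*z⁻¹≈1 q 0<∣q∣)))
  q^-suc -[1+ suc n ] = sym (trans
    (solve 3 (λ r x q → (r :* x) :* q := x :* (q :* r)) refl (q ⁻¹[ 0<∣q∣ ]) ((q ⁻¹[ 0<∣q∣ ]) ^ suc n) q)
    (trans (*-congˡ {x = (q ⁻¹[ 0<∣q∣ ]) ^ suc n} (z*z⁻¹≈1 q 0<∣q∣)) (*-identityʳ _)))

  q^-+ : ∀ i n → q^ (i ℤ.+ + n) ≈ q^ i * q ^ n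
  q^-+ i zero    = trans (reflexive (≡.cong q^_ (ℤ.+-identityʳ i))) (sym (*-identityʳ (q^ i)))
  q^-+ i (suc n) = trans
    (reflexive (≡.cong q^_ (ℤ-Solver.solve 2 (λ i n →
        i ℤ-Solver.:+ (ℤ-Solver.con (+ 1) ℤ-Solver.:+ n) ℤ-Solver.:=
        (i ℤ-Solver.:+ n) ℤ-Solver.:+ ℤ-Solver.con (+ 1)) ≡.refl i (+ n))))
    (trans (q^-suc (i ℤ.+ + n)) (trans (*-congʳ {x = q} (q^-+ i n))
      (trans (*-assoc _ _ _) (*-congˡ {x = q^ i} (*-comm (q ^ n) q)))))

  -- Splitting the summands by the recurrence

  -- The Gaussian binomial with an integral upper index.
  binomᶻ : ℤ → ℕ → ℂ
  binomᶻ (+ k)    l = binom k l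
  binomᶻ -[1+ k ] l = 0ᶜ

  binomᶻ≡gauss : ∀ k l → binomᶻ k l ≡ gauss k (+ l)
  binomᶻ≡gauss (+ k)    l = binom≡gauss k l
  binomᶻ≡gauss -[1+ k ] l = ≡.refl

  -- The quadratic form a² - 3ab + 3b².
  form : ℕ → ℕ → ℤ
  form a b = + a ℤ.* + a ℤ.- + 3 ℤ.* + a ℤ.* + b ℤ.+ + 3 ℤ.* + b ℤ.* + b

  -- The exponent of q in the summand with parameter e.
  exponent : ℤ → ℕ → ℕ → ℤ
  exponent e a b = form a b ℤ.+ e

  opaque
    -- The reciprocal of (q³; q³)_b.
    ρ : ℕ → ℂ
    ρ b = (q ^ 3 ⨾ q ^ 3) b ⁻¹[ 0<∣⨾∣ (0<∣z^n∣ 3 0<∣q∣) (∣z^1+n∣<1 2 0<∣q∣ ∣q∣<1) b ]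

    ρ-inverse : ∀ b → (q ^ 3 ⨾ q ^ 3) b * ρ b ≈ 1ᶜ
    ρ-inverse b = z*z⁻¹≈1 ((q ^ 3 ⨾ q ^ 3) b) _

    -- The summand, made opaque: it is used only through its factorisation
    -- into a power of q, the reciprocal ρ b and a binomial.
    cell : ℤ → ℤ → ℕ → ℕ → ℂ
    cell e k a b = summand e k a b

    cell≡summand : ∀ e k a b → cell e k a b ≡ summand e k a b
    cell≡summand e k a b = ≡.refl

    cell≡ : ∀ e k a b → cell e k a b ≡ q^ exponent e a b * ρ b * binomᶻ k a
    cell≡ e k a b = ≡.cong (λ x → q^ exponent e a b * ρ b * x) (≡.sym (binomᶻ≡gauss k a))

  cell≈ : ∀ e k a b → cell e k a b ≈ q^ exponent e a b * ρ b * binomᶻ k a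
  cell≈ e k a b = reflexive (cell≡ e k a b)

  cell-zero : ∀ e k a b → binomᶻ k a ≡ 0ᶜ → cell e k a b ≈ 0ᶜ
  cell-zero e k a b eq = trans (cell≈ e k a b)
    (trans (*-congˡ {x = q^ exponent e a b * ρ b} (reflexive eq)) (zeroʳ (q^ exponent e a b * ρ b)))

  -- The new parameter e + k + a - 3b collects the exponent k - 1 - a of the
  -- recurrence and the difference 2a + 1 - 3b of the values of the form at
  -- (a + 1 , b) and (a , b).  For k ≤ 0 all three binomials vanish.
  cell-pascal : ∀ e k a b → cell e k (suc a) b ≈
    cell e (k ℤ.- + 1) (suc a) b + cell (e ℤ.+ k ℤ.+ + a ℤ.- + 3 ℤ.* + b) (k ℤ.- + 1) a b
  cell-pascal e (+ zero)  a b = trans (cell-zero e (+ 0) (suc a) b (binom-zero (ℕ.s≤s ℕ.z≤n)))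
    (sym (trans (+-cong (cell-zero e -[1+ 0 ] (suc a) b ≡.refl) (cell-zero _ -[1+ 0 ] a b ≡.refl))
      (+-identityˡ 0ᶜ)))
  cell-pascal e -[1+ k ]  a b = trans (cell-zero e -[1+ k ] (suc a) b ≡.refl)
    (sym (trans (+-cong (cell-zero e (-[1+ k ] ℤ.- + 1) (suc a) b ≡.refl)
        (cell-zero _ (-[1+ k ] ℤ.- + 1) a b ≡.refl))
      (+-identityˡ 0ᶜ)))
  cell-pascal e (+ suc k) a b = trans (cell≈ e (+ suc k) (suc a) b)
    (trans (*-congˡ {x = q^ E₁ * ρ b} (binom-pascal k a))
      (trans (solve 5 (λ x r g p g′ → x :* r :* (g :+ p :* g′) := x :* r :* g :+ x :* p :* g′ :* r) refl
          (q^ E₁) (ρ b) (binom k (suc a)) (q ^ (k ℕ.∸ a)) (binom k a))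
        (sym (trans (+-cong (cell≈ e (+ k) (suc a) b) (cell≈ e′ (+ k) a b))
          (+-congˡ {x = q^ E₁ * ρ b * binom k (suc a)}
            (trans (solve 3 (λ x r g → x :* r :* g := x :* g :* r) refl (q^ E₂) (ρ b) (binom k a))
              (*-congʳ {x = ρ b} (absorb (ℕ.≤-<-connex a k)))))))))
    where
    e′ = e ℤ.+ + suc k ℤ.+ + a ℤ.- + 3 ℤ.* + b
    E₁ = exponent e (suc a) b
    E₂ = exponent e′ a b
    -- The powers of q agree when a ≤ k; otherwise the binomial [ k , a ] is 0.
    absorb : a ℕ.≤ k ⊎ k ℕ.< a → q^ E₂ * binom k a ≈ q^ E₁ * q ^ (k ℕ.∸ a) * binom k a
    absorb (inj₁ a≤k) = *-congʳ {x = binom k a}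
      (trans (reflexive (≡.cong q^_ E₂≡)) (q^-+ E₁ (k ℕ.∸ a)))
      where
      E₂≡ : E₂ ≡ E₁ ℤ.+ + (k ℕ.∸ a)
      E₂≡ = ≡.trans
        (ℤ-Solver.solve 4 (λ e k a b →
            a ⊛ a ⊖ # (+ 3) ⊛ a ⊛ b ⊕ # (+ 3) ⊛ b ⊛ b ⊕ (e ⊕ (# (+ 1) ⊕ k) ⊕ a ⊖ # (+ 3) ⊛ b) ⊜
            ((# (+ 1) ⊕ a) ⊛ (# (+ 1) ⊕ a) ⊖ # (+ 3) ⊛ (# (+ 1) ⊕ a) ⊛ b ⊕ # (+ 3) ⊛ b ⊛ b ⊕ e)
              ⊕ (k ⊖ a))
          ≡.refl e (+ k) (+ a) (+ b))
        (≡.cong (ℤ._+_ E₁) (≡.trans (ℤ.m-n≡m⊖n k a) (ℤ.⊖-≥ a≤k)))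
    absorb (inj₂ k<a) = trans (*-congˡ {x = q^ E₂} (reflexive (binom-zero k<a)))
      (trans (zeroʳ (q^ E₂)) (sym (trans
        (*-congˡ {x = q^ E₁ * q ^ (k ℕ.∸ a)} (reflexive (binom-zero k<a)))
        (zeroʳ (q^ E₁ * q ^ (k ℕ.∸ a))))))

  -- For k = 0 the claim fails: [ 0 , 0 ] = 1 and [ -1 , 0 ] = 0.
  cell-column-0 : ∀ e k b → k ≢ + 0 → cell e k 0 b ≈ cell e (k ℤ.- + 1) 0 b
  cell-column-0 e (+ zero)  b k≢0 = contradiction ≡.refl k≢0
  cell-column-0 e (+ suc k) b k≢0 = trans (cell≈ e (+ suc k) 0 b)
    (trans (*-congˡ {x = q^ exponent e 0 b * ρ b} (trans (binom-0 (suc k)) (sym (binom-0 k))))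
      (sym (cell≈ e (+ k) 0 b)))
  cell-column-0 e -[1+ k ]  b k≢0 = trans (cell-zero e -[1+ k ] 0 b ≡.refl)
    (sym (cell-zero e (-[1+ k ] ℤ.- + 1) 0 b ≡.refl))

  cell-origin : cell (+ 0) (+ 0) 0 0 ≈ 1ᶜ
  cell-origin = trans (cell≈ (+ 0) (+ 0) 0 0) (trans (*-cong
    (trans (*-identityˡ (ρ 0)) (trans (sym (*-identityˡ (ρ 0))) (ρ-inverse 0))) (binom-0 0))
    (*-identityˡ 1ᶜ))

  q^n*cell : ∀ n e k a b → q ^ n * cell e k a b ≈ cell (e ℤ.+ + n) k a b
  q^n*cell n e k a b = trans (*-congˡ {x = q ^ n} (cell≈ e k a b))
    (trans (solve 4 (λ p x r g → p :* (x :* r :* g) := x :* p :* r :* g) refl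
        (q ^ n) (q^ exponent e a b) (ρ b) (binomᶻ k a))
      (trans (*-congʳ {x = binomᶻ k a} (*-congʳ {x = ρ b} (sym
          (trans (reflexive (≡.cong q^_ (≡.sym (ℤ.+-assoc (form a b) e (+ n))))) (q^-+ (exponent e a b) n)))))
        (sym (cell≈ (e ℤ.+ + n) k a b))))

  -- Positivity of the quadratic form

  0≤i*i : ∀ i → + 0 ℤ.≤ i ℤ.* i
  0≤i*i (+ n)    = ≡.subst (+ 0 ℤ.≤_) (ℤ.pos-* n n) (ℤ.+≤+ ℕ.z≤n)
  0≤i*i -[1+ n ] = ℤ.+≤+ ℕ.z≤n

  0≤n*i : ∀ n {i} → + 0 ℤ.≤ i → + 0 ℤ.≤ + n ℤ.* i
  0≤n*i n {i} 0≤i = ≡.subst (ℤ._≤ + n ℤ.* i) (ℤ.*-zeroʳ (+ n)) (ℤ.*-monoˡ-≤-nonNeg (+ n) 0≤i)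

  -- The number P² + S² + 2 + 3N with P = N + 2 and S = 13N + 10.
  offset : ℕ → ℕ
  offset N = (N ℕ.+ 2) ℕ.* (N ℕ.+ 2) ℕ.+ (13 ℕ.* N ℕ.+ 10) ℕ.* (13 ℕ.* N ℕ.+ 10) ℕ.+ 2 ℕ.+ 3 ℕ.* N

  -- The form exceeds the linear function N (a + 5b + 3) up to a constant.
  -- With R = 5N + 2 the linear terms to be absorbed are P a + R b, and completing
  -- squares gives
  --   12 (form a b - P a - R b)
  --     = 3 (2a - 3b - P)² + (3b - S)² - 3P² - S²,   where S = 3P + 2R.
  -- The linear function is N times the exponent of the constant D in the bound
  -- for a summand.
  form-dominates : ∀ N a b d → ∃[ m ]
    form a b ℤ.+ (+ d ℤ.- + 2 ℤ.* + a ℤ.- + 2 ℤ.* + b ℤ.- + 2) ℤ.+ + offset N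
      ≡ + (m ℕ.+ N ℕ.* (a ℕ.+ 5 ℕ.* b ℕ.+ 3))
  form-dominates N a b d = ℤ.∣ Z ∣ , ≡.trans
      (ℤ-Solver.solve 2 (λ x y → x ⊜ (x ⊖ y) ⊕ y) ≡.refl _ (+ N ℤ.* (+ a ℤ.+ + 5 ℤ.* + b ℤ.+ + 3)))
      (≡.cong₂ ℤ._+_ (≡.sym (ℤ.0≤i⇒+∣i∣≡i 0≤Z))
        (≡.sym (≡.trans (ℤ.pos-* N _)
          (≡.cong (λ x → + N ℤ.* (+ a ℤ.+ x ℤ.+ + 3)) (ℤ.pos-* 5 b)))))
    where
    P S X Y Z : ℤ
    P = + N ℤ.+ + 2
    S = + 13 ℤ.* + N ℤ.+ + 10
    X = + 2 ℤ.* + a ℤ.- + 3 ℤ.* + b ℤ.- P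
    Y = + 3 ℤ.* + b ℤ.- S
    Z = form a b ℤ.+ (+ d ℤ.- + 2 ℤ.* + a ℤ.- + 2 ℤ.* + b ℤ.- + 2) ℤ.+ + offset N
      ℤ.- + N ℤ.* (+ a ℤ.+ + 5 ℤ.* + b ℤ.+ + 3)
    offset≡ : + offset N ≡ P ℤ.* P ℤ.+ S ℤ.* S ℤ.+ + 2 ℤ.+ + 3 ℤ.* + N
    offset≡ = ≡.cong₂ ℤ._+_
      (≡.cong (ℤ._+ + 2) (≡.cong₂ ℤ._+_ (ℤ.pos-* (N ℕ.+ 2) (N ℕ.+ 2))
        (≡.trans (ℤ.pos-* (13 ℕ.* N ℕ.+ 10) (13 ℕ.* N ℕ.+ 10)) (≡.cong₂ ℤ._*_ S≡ S≡))))
      (ℤ.pos-* 3 N)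
      where
      S≡ : + (13 ℕ.* N ℕ.+ 10) ≡ S
      S≡ = ≡.cong (ℤ._+ + 10) (ℤ.pos-* 13 N)
    squares : + 3 ℤ.* (X ℤ.* X) ℤ.+ Y ℤ.* Y ℤ.+ + 9 ℤ.* (P ℤ.* P) ℤ.+ + 11 ℤ.* (S ℤ.* S) ℤ.+ + 12 ℤ.* + d
      ≡ + 12 ℤ.* Z
    squares = ≡.trans
      (ℤ-Solver.solve 4 (λ n a b d →
          let p = n ⊕ # (+ 2)
              s = # (+ 13) ⊛ n ⊕ # (+ 10)
              x = # (+ 2) ⊛ a ⊖ # (+ 3) ⊛ b ⊖ p
              y = # (+ 3) ⊛ b ⊖ s
          in # (+ 3) ⊛ (x ⊛ x) ⊕ y ⊛ y ⊕ # (+ 9) ⊛ (p ⊛ p) ⊕ # (+ 11) ⊛ (s ⊛ s) ⊕ # (+ 12) ⊛ d ⊜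
            # (+ 12) ⊛ (a ⊛ a ⊖ # (+ 3) ⊛ a ⊛ b ⊕ # (+ 3) ⊛ b ⊛ b
              ⊕ (d ⊖ # (+ 2) ⊛ a ⊖ # (+ 2) ⊛ b ⊖ # (+ 2))
              ⊕ (p ⊛ p ⊕ s ⊛ s ⊕ # (+ 2) ⊕ # (+ 3) ⊛ n)
              ⊖ n ⊛ (a ⊕ # (+ 5) ⊛ b ⊕ # (+ 3))))
        ≡.refl (+ N) (+ a) (+ b) (+ d))
      (≡.cong (λ x → + 12 ℤ.* (form a b ℤ.+ (+ d ℤ.- + 2 ℤ.* + a ℤ.- + 2 ℤ.* + b ℤ.- + 2) ℤ.+ x
        ℤ.- + N ℤ.* (+ a ℤ.+ + 5 ℤ.* + b ℤ.+ + 3))) (≡.sym offset≡))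
    0≤Z : + 0 ℤ.≤ Z
    0≤Z = ℤ.*-cancelˡ-≤-pos (+ 0) Z (+ 12) (≡.subst (+ 0 ℤ.≤_) squares
      (ℤ.+-mono-≤ (ℤ.+-mono-≤ (ℤ.+-mono-≤ (ℤ.+-mono-≤ (0≤n*i 3 (0≤i*i X)) (0≤i*i Y))
        (0≤n*i 9 (0≤i*i P))) (0≤n*i 11 (0≤i*i S))) (0≤n*i 12 {+ d} (ℤ.+≤+ ℕ.z≤n))))

  -- Bounds for the factors of a summand

  -- The squared modulus of q.
  t : ℝ
  t = ∣ q ∣²

  0≤t : 0ᵣ ≤ t
  0≤t = R.<⇒≤ 0<∣q∣

  t<1 : t <ᵣ 1ᵣ
  t<1 = <-respʳ (R.*-identityˡ 1ᵣ) (proj₂ ∣q∣<1)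

  4# : ℝ
  4# = 1ᵣ R.+ 1ᵣ R.+ 1ᵣ R.+ 1ᵣ

  1≤4 : 1ᵣ ≤ 4#
  1≤4 = R.≤-respˡ
    (R.solve 0 (R.con (+ 1) R.:+ R.con (+ 0) R.:+ R.con (+ 0) R.:+ R.con (+ 0) R.:= R.con (+ 1)) R.refl)
    (R.+-mono-≤ (R.+-mono-≤ (R.+-mono-≤ R.≤-refl R.0≤1) R.0≤1) R.0≤1)

  0≤4 : 0ᵣ ≤ 4#
  0≤4 = R.≤-trans R.0≤1 1≤4

  ∣z^n∣² : ∀ z n → ∣ z ^ n ∣² R.≈ ∣ z ∣² R.^ n
  ∣z^n∣² z zero    = ∣1∣²
  ∣z^n∣² z (suc n) = R.trans (∣zw∣² z (z ^ n)) (R.*-cong R.refl (∣z^n∣² z n))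

  ∣0∣²≈0 : ∣ 0ᶜ ∣² R.≈ 0ᵣ
  ∣0∣²≈0 = R.solve 0 (R.con (+ 0) R.:* R.con (+ 0) R.:+ R.con (+ 0) R.:* R.con (+ 0) R.:= R.con (+ 0)) R.refl

  ∣0∣²≤4^ : ∀ k → ∣ 0ᶜ ∣² ≤ 4# R.^ k
  ∣0∣²≤4^ k = R.≤-respˡ (R.sym ∣0∣²≈0) (R.^-nonneg k 0≤4)

  ∣binom∣²≤ : ∀ k l → ∣ binom k l ∣² ≤ 4# R.^ k
  ∣binom∣²≤ k       zero    = R.≤-respˡ (R.sym (R.trans (∣∣²-cong (binom-0 k)) ∣1∣²)) (R.1≤^ k 1≤4)
  ∣binom∣²≤ zero    (suc l) = ≡.subst (λ z → ∣ z ∣² ≤ 1ᵣ) (≡.sym (binom-zero (ℕ.s≤s (ℕ.z≤n {l})))) (∣0∣²≤4^ 0)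
  ∣binom∣²≤ (suc k) (suc l) = R.≤-respˡ (R.sym (∣∣²-cong (binom-pascal k l)))
    (R.≤-trans (∣z+w∣²≤ (binom k (suc l)) (q ^ (k ℕ.∸ l) * binom k l))
      (R.≤-respʳ (R.solve 1 (λ x → R.con (+ 2) R.:* (x R.:+ x) R.:= R.con (+ 4) R.:* x) R.refl (4# R.^ k))
        (R.*-monoˡ-≤ (R.<⇒≤ R.0<2) (R.+-mono-≤ (∣binom∣²≤ k (suc l))
          (R.≤-respˡ (R.sym (∣zw∣² (q ^ (k ℕ.∸ l)) (binom k l)))
            (R.≤-respʳ (R.*-identityˡ (4# R.^ k))
              (R.*-mono-≤ (∣∣²-nonneg (q ^ (k ℕ.∸ l)))
                (R.≤-respˡ (R.sym (∣z^n∣² q (k ℕ.∸ l))) (R.^-≤1 (k ℕ.∸ l) 0≤t (R.<⇒≤ t<1)))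
                (R.^-nonneg k 0≤4) (∣binom∣²≤ k l))))))))

  ∣binomᶻ∣²≤ : ∀ {k n} l → k ℤ.≤ + n → ∣ binomᶻ k l ∣² ≤ 4# R.^ n
  ∣binomᶻ∣²≤ {+ k}          l (ℤ.+≤+ k≤n) = R.≤-trans (∣binom∣²≤ k l) (R.^-monoʳ-≤ 1≤4 k≤n)
  ∣binomᶻ∣²≤ { -[1+ k ]} {n} l _          = ∣0∣²≤4^ n

  0<½[1-t] : 0ᵣ <ᵣ ½ R.* (1ᵣ R.- t)
  0<½[1-t] = R.*-pos R.0<½ (x<y⇒0<y-x t<1)

  -- The number (1 - t) / 2 is a lower bound for 1 - Re z whenever |z|² ≤ t.  Its
  -- reciprocal is κ, so that C = κ² bounds |1 - z|⁻² for such z.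
  κ : ℝ
  κ = proj₁ (R.inverse 0<½[1-t])

  0≤κ : 0ᵣ ≤ κ
  0≤κ = R.<⇒≤ (proj₁ (proj₂ (R.inverse 0<½[1-t])))

  κ-inverse : (½ R.* (1ᵣ R.- t)) R.* κ R.≈ 1ᵣ
  κ-inverse = proj₂ (proj₂ (R.inverse 0<½[1-t]))

  C : ℝ
  C = κ R.* κ

  0≤C : 0ᵣ ≤ C
  0≤C = R.*-nonneg 0≤κ 0≤κ

  ½[1-t]≤1-re : ∀ z → ∣ z ∣² ≤ t → ½ R.* (1ᵣ R.- t) ≤ 1ᵣ R.- re z
  ½[1-t]≤1-re z ∣z∣²≤t = R.0≤y-x⇒x≤y (R.≤-respʳ halve
      (R.*-nonneg (R.<⇒≤ R.0<½) (R.+-nonneg (square-nonneg (1ᵣ R.- re z))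
        (x≤y⇒0≤y-x (R.≤-trans (re²≤∣∣² z) ∣z∣²≤t)))))
    where
    open R using (x≤y⇒0≤y-x)
    -- 2 (1 - x) = (1 - x)² + (1 - x²), and x² ≤ t for x = Re z.
    halve : ½ R.* ((1ᵣ R.- re z) R.* (1ᵣ R.- re z) R.+ (t R.- re z R.* re z))
      R.≈ 1ᵣ R.- re z R.- ½ R.* (1ᵣ R.- t)
    halve = R.trans (R.solve 3 (λ h x t →
        h R.:* ((R.con (+ 1) R.:- x) R.:* (R.con (+ 1) R.:- x) R.:+ (t R.:- x R.:* x)) R.:=
        (R.con (+ 2) R.:* h) R.:* (R.con (+ 1) R.:- x) R.:- h R.:* (R.con (+ 1) R.:- t)) R.refl ½ (re z) t)
      (R.+-cong (R.trans (R.*-cong R.2*½≈1 R.refl) (R.*-identityˡ _)) R.refl)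

  1≤∣1-z∣²C : ∀ z → ∣ z ∣² ≤ t → 1ᵣ ≤ ∣ 1ᶜ - z ∣² R.* C
  1≤∣1-z∣²C z ∣z∣²≤t = R.≤-respˡ (R.*-identityˡ 1ᵣ) (R.≤-trans
      (R.*-mono-≤ R.0≤1 1≤ (R.≤-trans R.0≤1 1≤) 1≤)
      (R.≤-respˡ (R.solve 2 (λ x c → (x R.:* x) R.:* (c R.:* c) R.:= (x R.:* c) R.:* (x R.:* c)) R.refl
          (1ᵣ R.- re z) κ)
        (R.*-monoʳ-≤ 0≤C (re²≤∣∣² (1ᶜ - z)))))
    where
    1≤ : 1ᵣ ≤ (1ᵣ R.- re z) R.* κ
    1≤ = R.≤-respˡ κ-inverse (R.*-monoʳ-≤ 0≤κ (½[1-t]≤1-re z ∣z∣²≤t))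

  -- Each factor of (q³; q³)_b is 1 - z for a power z = q^(3i) with i ≥ 1.
  1≤∣⨾∣²C^ : ∀ b → 1ᵣ ≤ ∣ (q ^ 3 ⨾ q ^ 3) b ∣² R.* C R.^ b
  1≤∣⨾∣²C^ zero    = R.≤-reflexive (R.sym (R.trans (R.*-identityʳ _) ∣1∣²))
  1≤∣⨾∣²C^ (suc b) = R.≤-respˡ (R.*-identityˡ 1ᵣ) (R.≤-respʳ
    (R.trans (R.solve 4 (λ x c y p → (x R.:* p) R.:* (y R.:* c) R.:= (x R.:* y) R.:* (c R.:* p)) R.refl
        (∣ (q ^ 3 ⨾ q ^ 3) b ∣²) C (∣ 1ᶜ - z ∣²) (C R.^ b))
      (R.*-cong (R.sym (∣zw∣² ((q ^ 3 ⨾ q ^ 3) b) (1ᶜ - z))) R.refl))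
    (R.*-mono-≤ R.0≤1 (1≤∣⨾∣²C^ b) (R.≤-trans R.0≤1 1≤) 1≤))
    where
    z : ℂ
    z = (q ^ 3) ^ b * q ^ 3
    ∣q³∣²≤t : ∣ q ^ 3 ∣² ≤ t
    ∣q³∣²≤t = R.≤-respˡ (R.sym (∣z^n∣² q 3)) (R.≤-respʳ (R.*-identityʳ t)
      (R.^-antimonoʳ-≤ 0≤t (R.<⇒≤ t<1) (ℕ.s≤s (ℕ.z≤n {2}))))
    1≤ : 1ᵣ ≤ ∣ 1ᶜ - z ∣² R.* C
    1≤ = 1≤∣1-z∣²C z (R.≤-respˡ (R.sym (∣zw∣² ((q ^ 3) ^ b) (q ^ 3))) (R.≤-respʳ (R.*-identityˡ t)
      (R.*-mono-≤ (∣∣²-nonneg ((q ^ 3) ^ b))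
        (R.≤-respˡ (R.sym (∣z^n∣² (q ^ 3) b))
          (R.^-≤1 b (∣∣²-nonneg (q ^ 3)) (R.≤-trans ∣q³∣²≤t (R.<⇒≤ t<1))))
        0≤t ∣q³∣²≤t)))

  ∣ρ∣²≤ : ∀ b → ∣ ρ b ∣² ≤ C R.^ b
  ∣ρ∣²≤ b = R.≤-respˡ (R.*-identityʳ _) (R.≤-respʳ
    (R.trans (R.solve 3 (λ r p c → r R.:* (p R.:* c) R.:= (p R.:* r) R.:* c) R.refl
        (∣ ρ b ∣²) (∣ (q ^ 3 ⨾ q ^ 3) b ∣²) (C R.^ b))
      (R.trans (R.*-cong (R.trans (R.sym (∣zw∣² ((q ^ 3 ⨾ q ^ 3) b) (ρ b)))
          (R.trans (∣∣²-cong (ρ-inverse b)) ∣1∣²)) R.refl)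
        (R.*-identityˡ _)))
    (R.*-monoˡ-≤ (∣∣²-nonneg (ρ b)) (1≤∣⨾∣²C^ b)))

  -- A common base for the exponential bounds C^b of the reciprocal of (q³; q³)_b,
  -- 4^(3b + 3) of the binomial and 4^(a + b) of the inverse squared weight.
  D : ℝ
  D = C R.+ 4#

  4≤D : 4# ≤ D
  4≤D = R.≤-respˡ (R.+-identityˡ 4#) (R.+-mono-≤ 0≤C R.≤-refl)

  C≤D : C ≤ D
  C≤D = R.≤-respˡ (R.+-identityʳ C) (R.+-mono-≤ R.≤-refl 0≤4)

  0≤D : 0ᵣ ≤ D
  0≤D = R.≤-trans 0≤C C≤D

  -- The exponent with which t beats D.
  N : ℕ
  N = proj₁ (R.powers-vanish D 0<∣q∣ t<1)

  t^ND≤1 : t R.^ N R.* D ≤ 1ᵣ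
  t^ND≤1 = proj₂ (R.powers-vanish D 0<∣q∣ t<1)

  t⁻¹ : ℝ
  t⁻¹ = proj₁ (R.inverse 0<∣q∣)

  -- The power t^-M with M = offset N.
  t⁻ᴹ : ℝ
  t⁻ᴹ = t⁻¹ R.^ offset N

  0≤t⁻ᴹ : 0ᵣ ≤ t⁻ᴹ
  0≤t⁻ᴹ = R.^-nonneg (offset N) (R.<⇒≤ (proj₁ (proj₂ (R.inverse 0<∣q∣))))

  tᴹ*t⁻ᴹ≈1 : t R.^ offset N R.* t⁻ᴹ R.≈ 1ᵣ
  tᴹ*t⁻ᴹ≈1 = R.trans (R.sym (R.^-distrib-* t t⁻¹ (offset N)))
    (R.trans (R.^-congˡ (offset N) (proj₂ (proj₂ (R.inverse 0<∣q∣)))) (R.1^n≈1 (offset N)))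

  -- If E + M ≥ N L, then |q^E|² = t^(E + M) t^-M ≤ t^(N L) t^-M.
  ∣q^∣²≤ : ∀ E m L → E ℤ.+ + offset N ≡ + (m ℕ.+ N ℕ.* L) → ∣ q^ E ∣² ≤ (t R.^ N) R.^ L R.* t⁻ᴹ
  ∣q^∣²≤ E m L eq = R.≤-respˡ
    (R.trans (R.*-assoc _ _ _) (R.trans (R.*-cong R.refl tᴹ*t⁻ᴹ≈1) (R.*-identityʳ _)))
    (R.*-monoʳ-≤ 0≤t⁻ᴹ (R.≤-respˡ (R.sym norm)
      (R.≤-respʳ (R.sym (R.^-assocʳ t N L))
        (R.^-antimonoʳ-≤ 0≤t (R.<⇒≤ t<1) (ℕ.m≤n+m (N ℕ.* L) m)))))
    where
    norm : ∣ q^ E ∣² R.* t R.^ offset N R.≈ t R.^ (m ℕ.+ N ℕ.* L)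
    norm = R.trans (R.*-cong R.refl (R.sym (∣z^n∣² q (offset N))))
      (R.trans (R.sym (∣zw∣² (q^ E) (q ^ offset N)))
        (R.trans (∣∣²-cong (sym (q^-+ E (offset N))))
          (R.trans (∣∣²-cong (reflexive (≡.cong q^_ eq))) (∣z^n∣² q (m ℕ.+ N ℕ.* L)))))

  1≤D^½^½^ : ∀ n → 1ᵣ ≤ D R.^ n R.* (½ R.^ n R.* ½ R.^ n)
  1≤D^½^½^ n = R.≤-respʳ
    (R.trans (R.^-distrib-* D (½ R.* ½) n) (R.*-cong R.refl (R.^-distrib-* ½ ½ n)))
    (R.1≤^ n (R.≤-trans
      (R.≤-reflexive (R.sym (R.trans
        (R.solve 1 (λ h → R.con (+ 4) R.:* (h R.:* h) R.:= (R.con (+ 2) R.:* h) R.:* (R.con (+ 2) R.:* h))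
          R.refl ½)
        (R.trans (R.*-cong R.2*½≈1 R.2*½≈1) (R.*-identityˡ 1ᵣ)))))
      (R.*-monoʳ-≤ (square-nonneg ½) 4≤D)))

  1≤D^w² : ∀ a b → 1ᵣ ≤ D R.^ (a ℕ.+ b) R.* (R.weight a b R.* R.weight a b)
  1≤D^w² a b = R.≤-respˡ (R.*-identityˡ 1ᵣ) (R.≤-respʳ
    (R.trans (R.solve 4 (λ x y h k →
          (x R.:* (h R.:* h)) R.:* (y R.:* (k R.:* k)) R.:= (x R.:* y) R.:* ((h R.:* k) R.:* (h R.:* k)))
        R.refl (D R.^ a) (D R.^ b) (½ R.^ a) (½ R.^ b))
      (R.*-cong (R.sym (R.^-homo-* D a b)) R.refl))
    (R.*-mono-≤ R.0≤1 (1≤D^½^½^ a) (R.≤-trans R.0≤1 (1≤D^½^½^ b)) (1≤D^½^½^ b)))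

  -- The constant in the domination; its square is at least t^-M.
  B : ℝ
  B = 1ᵣ R.+ t⁻ᴹ

  1≤B : 1ᵣ ≤ B
  1≤B = R.≤-respˡ (R.+-identityʳ 1ᵣ) (R.+-mono-≤ R.≤-refl 0≤t⁻ᴹ)

  0≤B : 0ᵣ ≤ B
  0≤B = R.≤-trans R.0≤1 1≤B

  t⁻ᴹ≤BB : t⁻ᴹ ≤ B R.* B
  t⁻ᴹ≤BB = R.≤-trans (R.≤-respˡ (R.+-identityˡ t⁻ᴹ) (R.+-mono-≤ R.0≤1 R.≤-refl))
    (R.≤-respʳ R.refl (R.≤-respˡ (R.*-identityʳ B) (R.*-monoˡ-≤ 0≤B 1≤B)))

  -- The hypotheses say e ≥ - 2a - 2b - 2 and k ≤ 3b + 3.  The factors are at most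
  -- t^(N L) t^-M, D^b and D^(3b + 3); multiplying by D^(a + b) w² ≥ 1 makes the
  -- exponent of D equal to L = a + 5b + 3, and (t^N D)^L ≤ 1.
  cell-bound : ∀ e k a b d → e ≡ + d ℤ.- + 2 ℤ.* + a ℤ.- + 2 ℤ.* + b ℤ.- + 2 → k ℤ.≤ + (3 ℕ.* b ℕ.+ 3) →
    ∣ cell e k a b ∣² ≤ (B R.* R.weight a b) R.* (B R.* R.weight a b)
  cell-bound e k a b d e≡ k≤ =
    R.≤-respˡ (R.sym (R.trans (∣∣²-cong (cell≈ e k a b))
      (R.trans (∣zw∣² (q^ E * ρ b) (binomᶻ k a)) (R.*-cong (∣zw∣² (q^ E) (ρ b)) R.refl))))
    (R.≤-trans (R.*-mono-≤ (R.*-nonneg (∣∣²-nonneg (q^ E)) (∣∣²-nonneg (ρ b)))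
        (R.*-mono-≤ (∣∣²-nonneg (q^ E)) (∣q^∣²≤ E m L E+M≡) (R.^-nonneg b 0≤D)
          (R.≤-trans (∣ρ∣²≤ b) (R.^-monoˡ-≤ b 0≤C C≤D)))
        (R.^-nonneg K 0≤D)
        (R.≤-trans (∣binomᶻ∣²≤ a k≤) (R.^-monoˡ-≤ K 0≤4 4≤D)))
    (R.≤-trans (R.≤-respˡ (R.*-identityʳ _) (R.*-monoˡ-≤
        (R.*-nonneg (R.*-nonneg (R.*-nonneg (R.^-nonneg L (R.^-nonneg N 0≤t)) 0≤t⁻ᴹ) (R.^-nonneg b 0≤D))
          (R.^-nonneg K 0≤D)) (1≤D^w² a b)))
    (R.≤-respˡ (R.sym collect) (R.≤-respʳ
      (R.solve 2 (λ B w → (B R.:* B) R.:* (w R.:* w) R.:= (B R.:* w) R.:* (B R.:* w)) R.refl B w)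
      (R.*-mono-≤ (R.*-nonneg (R.^-nonneg L (R.*-nonneg (R.^-nonneg N 0≤t) 0≤D)) 0≤t⁻ᴹ)
        (R.≤-trans (R.*-monoʳ-≤ 0≤t⁻ᴹ (R.^-≤1 L (R.*-nonneg (R.^-nonneg N 0≤t) 0≤D) t^ND≤1))
          (R.≤-respˡ (R.sym (R.*-identityˡ t⁻ᴹ)) t⁻ᴹ≤BB))
        (square-nonneg w) R.≤-refl)))))
    where
    E = exponent e a b
    K = 3 ℕ.* b ℕ.+ 3
    L = a ℕ.+ 5 ℕ.* b ℕ.+ 3
    w = R.weight a b
    m = proj₁ (form-dominates N a b d)
    E+M≡ : E ℤ.+ + offset N ≡ + (m ℕ.+ N ℕ.* L)
    E+M≡ = ≡.trans (≡.cong (λ x → form a b ℤ.+ x ℤ.+ + offset N) e≡) (proj₂ (form-dominates N a b d))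
    L≡ : b ℕ.+ K ℕ.+ (a ℕ.+ b) ≡ L
    L≡ = ℕ-Solver.solve 2 (λ a b →
        b ℕ-Solver.:+ (ℕ-Solver.con 3 ℕ-Solver.:* b ℕ-Solver.:+ ℕ-Solver.con 3) ℕ-Solver.:+ (a ℕ-Solver.:+ b)
        ℕ-Solver.:= a ℕ-Solver.:+ ℕ-Solver.con 5 ℕ-Solver.:* b ℕ-Solver.:+ ℕ-Solver.con 3) ≡.refl a b
      where module ℕ-Solver = Data.Nat.Solver.+-*-Solver
    D^L≈ : D R.^ L R.≈ D R.^ b R.* D R.^ K R.* D R.^ (a ℕ.+ b)
    D^L≈ = R.trans (R.reflexive (≡.cong (D R.^_) (≡.sym L≡)))
      (R.trans (R.^-homo-* D (b ℕ.+ K) (a ℕ.+ b)) (R.*-cong (R.^-homo-* D b K) R.refl))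
    collect : (t R.^ N) R.^ L R.* t⁻ᴹ R.* D R.^ b R.* D R.^ K R.* (D R.^ (a ℕ.+ b) R.* (w R.* w))
      R.≈ (t R.^ N R.* D) R.^ L R.* t⁻ᴹ R.* (w R.* w)
    collect = R.trans
      (R.solve 6 (λ x T u v y w → x R.:* T R.:* u R.:* v R.:* (y R.:* w) R.:=
          x R.:* (u R.:* v R.:* y) R.:* T R.:* w) R.refl
        ((t R.^ N) R.^ L) t⁻ᴹ (D R.^ b) (D R.^ K) (D R.^ (a ℕ.+ b)) (w R.* w))
      (R.*-cong (R.*-cong (R.trans (R.*-cong R.refl (R.sym D^L≈))
        (R.sym (R.^-distrib-* (t R.^ N) D L))) R.refl) R.refl)

  -- The twelve series

  -- The parameters e and k of the summands of each series.
  shiftOf topOf : Label → ℕ → ℕ → ℤ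
  shiftOf F₀  a b = + a ℤ.- + b
  shiftOf F₁  a b = + a ℤ.- + b
  shiftOf F₂  a b = + a ℤ.- + b ℤ.- + 2
  shiftOf G₀  a b = + 2 ℤ.* + b ℤ.+ + 1
  shiftOf G₁  a b = + 2 ℤ.* + b ℤ.+ + 1
  shiftOf G₂  a b = + 2 ℤ.* + b ℤ.- + 1
  shiftOf F₀⋆ a b = + a ℤ.- + 2 ℤ.* + b
  shiftOf F₁⋆ a b = + a ℤ.- + 2 ℤ.* + b
  shiftOf F₂⋆ a b = + a ℤ.- + 2 ℤ.* + b
  shiftOf G₀⋆ a b = + 4 ℤ.* + b ℤ.- + 2 ℤ.* + a ℤ.+ + 1
  shiftOf G₁⋆ a b = + 4 ℤ.* + b ℤ.- + 2 ℤ.* + a ℤ.+ + 1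
  shiftOf G₂⋆ a b = + 4 ℤ.* + b ℤ.- + 2 ℤ.* + a ℤ.+ + 1
  topOf F₀  a b = + 3 ℤ.* + b ℤ.- + a
  topOf F₁  a b = + 3 ℤ.* + b ℤ.- + a ℤ.- + 1
  topOf F₂  a b = + 3 ℤ.* + b ℤ.- + a ℤ.- + 2
  topOf G₀  a b = + 3 ℤ.* + b ℤ.- + a ℤ.+ + 1
  topOf G₁  a b = + 3 ℤ.* + b ℤ.- + a
  topOf G₂  a b = + 3 ℤ.* + b ℤ.- + a ℤ.- + 1
  topOf F₀⋆ a b = + 3 ℤ.* + b ℤ.- + a ℤ.- + 1
  topOf F₁⋆ a b = + 3 ℤ.* + b ℤ.- + a ℤ.- + 2
  topOf F₂⋆ a b = + 3 ℤ.* + b ℤ.- + a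
  topOf G₀⋆ a b = + 3 ℤ.* + b ℤ.- + a ℤ.+ + 2
  topOf G₁⋆ a b = + 3 ℤ.* + b ℤ.- + a ℤ.+ + 1
  topOf G₂⋆ a b = + 3 ℤ.* + b ℤ.- + a ℤ.+ + 3

  -- The summands of the series i, in the opaque form.
  cells : Label → ℕ → ℕ → ℂ
  cells i a b = cell (shiftOf i a b) (topOf i a b) a b

  cells≡term : ∀ i a b → cells i a b ≡ term i a b
  cells≡term F₀  a b = cell≡summand (shiftOf F₀ a b) (topOf F₀ a b) a b
  cells≡term F₁  a b = cell≡summand (shiftOf F₁ a b) (topOf F₁ a b) a b
  cells≡term F₂  a b = cell≡summand (shiftOf F₂ a b) (topOf F₂ a b) a b
  cells≡term G₀  a b = cell≡summand (shiftOf G₀ a b) (topOf G₀ a b) a b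
  cells≡term G₁  a b = cell≡summand (shiftOf G₁ a b) (topOf G₁ a b) a b
  cells≡term G₂  a b = cell≡summand (shiftOf G₂ a b) (topOf G₂ a b) a b
  cells≡term F₀⋆ a b = cell≡summand (shiftOf F₀⋆ a b) (topOf F₀⋆ a b) a b
  cells≡term F₁⋆ a b = cell≡summand (shiftOf F₁⋆ a b) (topOf F₁⋆ a b) a b
  cells≡term F₂⋆ a b = cell≡summand (shiftOf F₂⋆ a b) (topOf F₂⋆ a b) a b
  cells≡term G₀⋆ a b = cell≡summand (shiftOf G₀⋆ a b) (topOf G₀⋆ a b) a b
  cells≡term G₁⋆ a b = cell≡summand (shiftOf G₁⋆ a b) (topOf G₁⋆ a b) a b
  cells≡term G₂⋆ a b = cell≡summand (shiftOf G₂⋆ a b) (topOf G₂⋆ a b) a b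

  -- The amount e + 2a + 2b + 2, a natural number for each of the series.
  slack : Label → ℕ → ℕ → ℕ
  slack F₀  a b = a ℕ.+ a ℕ.+ a ℕ.+ b ℕ.+ 2
  slack F₁  a b = a ℕ.+ a ℕ.+ a ℕ.+ b ℕ.+ 2
  slack F₂  a b = a ℕ.+ a ℕ.+ a ℕ.+ b
  slack G₀  a b = a ℕ.+ a ℕ.+ b ℕ.+ b ℕ.+ b ℕ.+ b ℕ.+ 3
  slack G₁  a b = a ℕ.+ a ℕ.+ b ℕ.+ b ℕ.+ b ℕ.+ b ℕ.+ 3
  slack G₂  a b = a ℕ.+ a ℕ.+ b ℕ.+ b ℕ.+ b ℕ.+ b ℕ.+ 1
  slack F₀⋆ a b = a ℕ.+ a ℕ.+ a ℕ.+ 2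
  slack F₁⋆ a b = a ℕ.+ a ℕ.+ a ℕ.+ 2
  slack F₂⋆ a b = a ℕ.+ a ℕ.+ a ℕ.+ 2
  slack G₀⋆ a b = b ℕ.+ b ℕ.+ b ℕ.+ b ℕ.+ b ℕ.+ b ℕ.+ 3
  slack G₁⋆ a b = b ℕ.+ b ℕ.+ b ℕ.+ b ℕ.+ b ℕ.+ b ℕ.+ 3
  slack G₂⋆ a b = b ℕ.+ b ℕ.+ b ℕ.+ b ℕ.+ b ℕ.+ b ℕ.+ 3

  shiftOf≡ : ∀ i a b →
    shiftOf i a b ≡ + slack i a b ℤ.- + 2 ℤ.* + a ℤ.- + 2 ℤ.* + b ℤ.- + 2
  shiftOf≡ F₀ a b = ℤ-Solver.solve 2 (λ a b → a ⊖ b ⊜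
    a ⊕ a ⊕ a ⊕ b ⊕ # (+ 2) ⊖ # (+ 2) ⊛ a ⊖ # (+ 2) ⊛ b ⊖ # (+ 2)) ≡.refl (+ a) (+ b)
  shiftOf≡ F₁ a b = ℤ-Solver.solve 2 (λ a b → a ⊖ b ⊜
    a ⊕ a ⊕ a ⊕ b ⊕ # (+ 2) ⊖ # (+ 2) ⊛ a ⊖ # (+ 2) ⊛ b ⊖ # (+ 2)) ≡.refl (+ a) (+ b)
  shiftOf≡ F₂ a b = ℤ-Solver.solve 2 (λ a b → a ⊖ b ⊖ # (+ 2) ⊜
    a ⊕ a ⊕ a ⊕ b ⊖ # (+ 2) ⊛ a ⊖ # (+ 2) ⊛ b ⊖ # (+ 2)) ≡.refl (+ a) (+ b)
  shiftOf≡ G₀ a b = ℤ-Solver.solve 2 (λ a b → # (+ 2) ⊛ b ⊕ # (+ 1) ⊜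
    a ⊕ a ⊕ b ⊕ b ⊕ b ⊕ b ⊕ # (+ 3) ⊖ # (+ 2) ⊛ a ⊖ # (+ 2) ⊛ b ⊖ # (+ 2)) ≡.refl (+ a) (+ b)
  shiftOf≡ G₁ a b = ℤ-Solver.solve 2 (λ a b → # (+ 2) ⊛ b ⊕ # (+ 1) ⊜
    a ⊕ a ⊕ b ⊕ b ⊕ b ⊕ b ⊕ # (+ 3) ⊖ # (+ 2) ⊛ a ⊖ # (+ 2) ⊛ b ⊖ # (+ 2)) ≡.refl (+ a) (+ b)
  shiftOf≡ G₂ a b = ℤ-Solver.solve 2 (λ a b → # (+ 2) ⊛ b ⊖ # (+ 1) ⊜
    a ⊕ a ⊕ b ⊕ b ⊕ b ⊕ b ⊕ # (+ 1) ⊖ # (+ 2) ⊛ a ⊖ # (+ 2) ⊛ b ⊖ # (+ 2)) ≡.refl (+ a) (+ b)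
  shiftOf≡ F₀⋆ a b = ℤ-Solver.solve 2 (λ a b → a ⊖ # (+ 2) ⊛ b ⊜
    a ⊕ a ⊕ a ⊕ # (+ 2) ⊖ # (+ 2) ⊛ a ⊖ # (+ 2) ⊛ b ⊖ # (+ 2)) ≡.refl (+ a) (+ b)
  shiftOf≡ F₁⋆ a b = ℤ-Solver.solve 2 (λ a b → a ⊖ # (+ 2) ⊛ b ⊜
    a ⊕ a ⊕ a ⊕ # (+ 2) ⊖ # (+ 2) ⊛ a ⊖ # (+ 2) ⊛ b ⊖ # (+ 2)) ≡.refl (+ a) (+ b)
  shiftOf≡ F₂⋆ a b = ℤ-Solver.solve 2 (λ a b → a ⊖ # (+ 2) ⊛ b ⊜
    a ⊕ a ⊕ a ⊕ # (+ 2) ⊖ # (+ 2) ⊛ a ⊖ # (+ 2) ⊛ b ⊖ # (+ 2)) ≡.refl (+ a) (+ b)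
  shiftOf≡ G₀⋆ a b = ℤ-Solver.solve 2 (λ a b → # (+ 4) ⊛ b ⊖ # (+ 2) ⊛ a ⊕ # (+ 1) ⊜
    b ⊕ b ⊕ b ⊕ b ⊕ b ⊕ b ⊕ # (+ 3) ⊖ # (+ 2) ⊛ a ⊖ # (+ 2) ⊛ b ⊖ # (+ 2)) ≡.refl (+ a) (+ b)
  shiftOf≡ G₁⋆ a b = ℤ-Solver.solve 2 (λ a b → # (+ 4) ⊛ b ⊖ # (+ 2) ⊛ a ⊕ # (+ 1) ⊜
    b ⊕ b ⊕ b ⊕ b ⊕ b ⊕ b ⊕ # (+ 3) ⊖ # (+ 2) ⊛ a ⊖ # (+ 2) ⊛ b ⊖ # (+ 2)) ≡.refl (+ a) (+ b)
  shiftOf≡ G₂⋆ a b = ℤ-Solver.solve 2 (λ a b → # (+ 4) ⊛ b ⊖ # (+ 2) ⊛ a ⊕ # (+ 1) ⊜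
    b ⊕ b ⊕ b ⊕ b ⊕ b ⊕ b ⊕ # (+ 3) ⊖ # (+ 2) ⊛ a ⊖ # (+ 2) ⊛ b ⊖ # (+ 2)) ≡.refl (+ a) (+ b)

  topOf≤ : ∀ i a b → topOf i a b ℤ.≤ + (3 ℕ.* b ℕ.+ 3)
  topOf≤ i a b = ≡.subst₂ ℤ._≤_ (≡.sym (topOf≡ i)) (≡.cong (ℤ._+ + 3) (≡.sym (ℤ.pos-* 3 b)))
      (ℤ.i-j≤i (+ 3 ℤ.* + b ℤ.+ + 3) (+ (a ℕ.+ deficit i)))
    where
    -- The upper index is 3b + 3 - (a + deficit).
    deficit : Label → ℕ
    deficit F₀ = 3
    deficit F₁ = 4
    deficit F₂ = 5
    deficit G₀ = 2
    deficit G₁ = 3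
    deficit G₂ = 4
    deficit F₀⋆ = 4
    deficit F₁⋆ = 5
    deficit F₂⋆ = 3
    deficit G₀⋆ = 1
    deficit G₁⋆ = 2
    deficit G₂⋆ = 0
    topOf≡ : ∀ i → topOf i a b ≡ + 3 ℤ.* + b ℤ.+ + 3 ℤ.- + (a ℕ.+ deficit i)
    topOf≡ F₀ = ℤ-Solver.solve 2 (λ a b → # (+ 3) ⊛ b ⊖ a ⊜
      # (+ 3) ⊛ b ⊕ # (+ 3) ⊖ (a ⊕ # (+ 3))) ≡.refl (+ a) (+ b)
    topOf≡ F₁ = ℤ-Solver.solve 2 (λ a b → # (+ 3) ⊛ b ⊖ a ⊖ # (+ 1) ⊜
      # (+ 3) ⊛ b ⊕ # (+ 3) ⊖ (a ⊕ # (+ 4))) ≡.refl (+ a) (+ b)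
    topOf≡ F₂ = ℤ-Solver.solve 2 (λ a b → # (+ 3) ⊛ b ⊖ a ⊖ # (+ 2) ⊜
      # (+ 3) ⊛ b ⊕ # (+ 3) ⊖ (a ⊕ # (+ 5))) ≡.refl (+ a) (+ b)
    topOf≡ G₀ = ℤ-Solver.solve 2 (λ a b → # (+ 3) ⊛ b ⊖ a ⊕ # (+ 1) ⊜
      # (+ 3) ⊛ b ⊕ # (+ 3) ⊖ (a ⊕ # (+ 2))) ≡.refl (+ a) (+ b)
    topOf≡ G₁ = ℤ-Solver.solve 2 (λ a b → # (+ 3) ⊛ b ⊖ a ⊜
      # (+ 3) ⊛ b ⊕ # (+ 3) ⊖ (a ⊕ # (+ 3))) ≡.refl (+ a) (+ b)
    topOf≡ G₂ = ℤ-Solver.solve 2 (λ a b → # (+ 3) ⊛ b ⊖ a ⊖ # (+ 1) ⊜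
      # (+ 3) ⊛ b ⊕ # (+ 3) ⊖ (a ⊕ # (+ 4))) ≡.refl (+ a) (+ b)
    topOf≡ F₀⋆ = ℤ-Solver.solve 2 (λ a b → # (+ 3) ⊛ b ⊖ a ⊖ # (+ 1) ⊜
      # (+ 3) ⊛ b ⊕ # (+ 3) ⊖ (a ⊕ # (+ 4))) ≡.refl (+ a) (+ b)
    topOf≡ F₁⋆ = ℤ-Solver.solve 2 (λ a b → # (+ 3) ⊛ b ⊖ a ⊖ # (+ 2) ⊜
      # (+ 3) ⊛ b ⊕ # (+ 3) ⊖ (a ⊕ # (+ 5))) ≡.refl (+ a) (+ b)
    topOf≡ F₂⋆ = ℤ-Solver.solve 2 (λ a b → # (+ 3) ⊛ b ⊖ a ⊜
      # (+ 3) ⊛ b ⊕ # (+ 3) ⊖ (a ⊕ # (+ 3))) ≡.refl (+ a) (+ b)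
    topOf≡ G₀⋆ = ℤ-Solver.solve 2 (λ a b → # (+ 3) ⊛ b ⊖ a ⊕ # (+ 2) ⊜
      # (+ 3) ⊛ b ⊕ # (+ 3) ⊖ (a ⊕ # (+ 1))) ≡.refl (+ a) (+ b)
    topOf≡ G₁⋆ = ℤ-Solver.solve 2 (λ a b → # (+ 3) ⊛ b ⊖ a ⊕ # (+ 1) ⊜
      # (+ 3) ⊛ b ⊕ # (+ 3) ⊖ (a ⊕ # (+ 2))) ≡.refl (+ a) (+ b)
    topOf≡ G₂⋆ = ℤ-Solver.solve 2 (λ a b → # (+ 3) ⊛ b ⊖ a ⊕ # (+ 3) ⊜
      # (+ 3) ⊛ b ⊕ # (+ 3) ⊖ (a ⊕ # (+ 0))) ≡.refl (+ a) (+ b)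

  term-summable : ∀ i → Summable (term i)
  term-summable i = dominated⇒summable B 0≤B λ a b →
    ≡.subst (λ z → ∣ z ∣² ≤ (B R.* R.weight a b) R.* (B R.* R.weight a b)) (cells≡term i a b)
      (cell-bound (shiftOf i a b) (topOf i a b) a b (slack i a b) (shiftOf≡ i a b) (topOf≤ i a b))

  HasSum-cells : ∀ {i x} → term i HasSum x → cells i HasSum x
  HasSum-cells {i} = HasSum-cong (λ a b → reflexive (≡.sym (cells≡term i a b)))

  -- The matching of exponents and indices that turns the recurrence of the
  -- binomials into the relation
  --   cells i (a + 1) b = cells j (a + 1) b + q^n cells l a b,
  -- stated between the parameters in cell-pascal and those of the series j and l.
  record Recurrence (i j l : Label) (n : ℕ) : Set where
    field
      shift₁ : ∀ a b → shiftOf i a b ≡ shiftOf j a b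
      top₁   : ∀ a b → topOf i a b ℤ.- + 1 ≡ topOf j a b
      shift₂ : ∀ a b → shiftOf i (suc a) b ℤ.+ topOf i (suc a) b ℤ.+ + a ℤ.- + 3 ℤ.* + b
                         ≡ shiftOf l a b ℤ.+ + n
      top₂   : ∀ a b → topOf i (suc a) b ℤ.- + 1 ≡ topOf l a b

  module _ {i j l : Label} {n : ℕ} (rec : Recurrence i j l n) where
    open Recurrence rec

    column-0 : ∀ b → topOf i 0 b ≢ + 0 → cells i 0 b ≈ cells j 0 b
    column-0 b top≢0 = trans (cell-column-0 (shiftOf i 0 b) (topOf i 0 b) b top≢0)
      (reflexive (≡.cong₂ (λ e k → cell e k 0 b) (shift₁ 0 b) (top₁ 0 b)))

    column-suc : ∀ a b → cells i (suc a) b ≈ cells j (suc a) b + q ^ n * cells l a b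
    column-suc a b = trans (cell-pascal (shiftOf i (suc a) b) (topOf i (suc a) b) a b)
      (+-cong (reflexive (≡.cong₂ (λ e k → cell e k (suc a) b) (shift₁ (suc a) b) (top₁ (suc a) b)))
        (trans (reflexive (≡.cong₂ (λ e k → cell e k a b) (shift₂ a b) (top₂ a b)))
          (sym (q^n*cell n (shiftOf l a b) (topOf l a b) a b))))

    HasSum-rhs : ∀ {y z} → cells j HasSum y → cells l HasSum z →
      (λ a b → cells j a b + q ^ n * delay (cells l) a b) HasSum (y + q ^ n * z)
    HasSum-rhs y z = HasSum-+ y (HasSum-* (q ^ n) (HasSum-delay z))

    -- The upper index of the series i never vanishes at a = 0.
    relation : (∀ b → topOf i 0 b ≢ + 0) → ∀ {x y z} →
      cells i HasSum x → cells j HasSum y → cells l HasSum z → x ≈ y + q ^ n * z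
    relation top≢0 x y z = HasSum-unique x (HasSum-cong pointwise (HasSum-rhs y z))
      where
      pointwise : ∀ a b → cells j a b + q ^ n * delay (cells l) a b ≈ cells i a b
      pointwise zero    b = trans (+-congˡ {x = cells j 0 b} (zeroʳ (q ^ n)))
        (trans (+-identityʳ (cells j 0 b)) (sym (column-0 b (top≢0 b))))
      pointwise (suc a) b = sym (column-suc a b)

    -- The upper index of the series i vanishes at a = b = 0.
    relation+1 : (∀ b → topOf i 0 (suc b) ≢ + 0) → cells i 0 0 ≈ 1ᶜ → cells j 0 0 ≈ 0ᶜ → ∀ {x y z} →
      cells i HasSum x → cells j HasSum y → cells l HasSum z → x ≈ y + q ^ n * z + 1ᶜ
    relation+1 top≢0 cellsᵢ≈1 cellsⱼ≈0 x y z =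
      HasSum-unique x (HasSum-cong pointwise (HasSum-+ (HasSum-rhs y z) HasSum-δ₀))
      where
      pointwise : ∀ a b → cells j a b + q ^ n * delay (cells l) a b + δ₀ a b ≈ cells i a b
      pointwise zero    zero    = trans (+-congʳ {x = 1ᶜ}
        (trans (+-cong cellsⱼ≈0 (zeroʳ (q ^ n))) (+-identityˡ 0ᶜ)))
        (trans (+-identityˡ 1ᶜ) (sym cellsᵢ≈1))
      pointwise zero    (suc b) = trans (+-identityʳ _) (trans (+-congˡ {x = cells j 0 (suc b)} (zeroʳ (q ^ n)))
        (trans (+-identityʳ (cells j 0 (suc b))) (sym (column-0 (suc b) (top≢0 b)))))
      pointwise (suc a) b       = trans (+-identityʳ _) (sym (column-suc a b))

  F-recurrence : Recurrence F₀ F₁ F₂ 2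
  F-recurrence = record
    { shift₁ = λ _ _ → ≡.refl
    ; top₁   = λ a b → ℤ-Solver.solve 2 (λ a b →
        # (+ 3) ⊛ b ⊖ a ⊖ # (+ 1) ⊜ # (+ 3) ⊛ b ⊖ a ⊖ # (+ 1)) ≡.refl (+ a) (+ b)
    ; shift₂ = λ a b → ℤ-Solver.solve 2 (λ a b →
        ((# (+ 1) ⊕ a) ⊖ b) ⊕ (# (+ 3) ⊛ b ⊖ (# (+ 1) ⊕ a)) ⊕ a ⊖ # (+ 3) ⊛ b ⊜
        a ⊖ b ⊖ # (+ 2) ⊕ # (+ 2)) ≡.refl (+ a) (+ b)
    ; top₂   = λ a b → ℤ-Solver.solve 2 (λ a b →
        # (+ 3) ⊛ b ⊖ (# (+ 1) ⊕ a) ⊖ # (+ 1) ⊜ # (+ 3) ⊛ b ⊖ a ⊖ # (+ 2)) ≡.refl (+ a) (+ b)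
    }

  G-recurrence : Recurrence G₀ G₁ G₂ 2
  G-recurrence = record
    { shift₁ = λ _ _ → ≡.refl
    ; top₁   = λ a b → ℤ-Solver.solve 2 (λ a b →
        # (+ 3) ⊛ b ⊖ a ⊕ # (+ 1) ⊖ # (+ 1) ⊜ # (+ 3) ⊛ b ⊖ a) ≡.refl (+ a) (+ b)
    ; shift₂ = λ a b → ℤ-Solver.solve 2 (λ a b →
        (# (+ 2) ⊛ b ⊕ # (+ 1)) ⊕ (# (+ 3) ⊛ b ⊖ (# (+ 1) ⊕ a) ⊕ # (+ 1)) ⊕ a ⊖ # (+ 3) ⊛ b ⊜
        # (+ 2) ⊛ b ⊖ # (+ 1) ⊕ # (+ 2)) ≡.refl (+ a) (+ b)
    ; top₂   = λ a b → ℤ-Solver.solve 2 (λ a b →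
        # (+ 3) ⊛ b ⊖ (# (+ 1) ⊕ a) ⊕ # (+ 1) ⊖ # (+ 1) ⊜ # (+ 3) ⊛ b ⊖ a ⊖ # (+ 1)) ≡.refl (+ a) (+ b)
    }

  F⋆-recurrence : Recurrence F₂⋆ F₀⋆ F₁⋆ 0
  F⋆-recurrence = record
    { shift₁ = λ _ _ → ≡.refl
    ; top₁   = λ a b → ℤ-Solver.solve 2 (λ a b →
        # (+ 3) ⊛ b ⊖ a ⊖ # (+ 1) ⊜ # (+ 3) ⊛ b ⊖ a ⊖ # (+ 1)) ≡.refl (+ a) (+ b)
    ; shift₂ = λ a b → ℤ-Solver.solve 2 (λ a b →
        ((# (+ 1) ⊕ a) ⊖ # (+ 2) ⊛ b) ⊕ (# (+ 3) ⊛ b ⊖ (# (+ 1) ⊕ a)) ⊕ a ⊖ # (+ 3) ⊛ b ⊜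
        a ⊖ # (+ 2) ⊛ b ⊕ # (+ 0)) ≡.refl (+ a) (+ b)
    ; top₂   = λ a b → ℤ-Solver.solve 2 (λ a b →
        # (+ 3) ⊛ b ⊖ (# (+ 1) ⊕ a) ⊖ # (+ 1) ⊜ # (+ 3) ⊛ b ⊖ a ⊖ # (+ 2)) ≡.refl (+ a) (+ b)
    }

  G⋆-recurrence : Recurrence G₂⋆ G₀⋆ G₁⋆ 0
  G⋆-recurrence = record
    { shift₁ = λ _ _ → ≡.refl
    ; top₁   = λ a b → ℤ-Solver.solve 2 (λ a b →
        # (+ 3) ⊛ b ⊖ a ⊕ # (+ 3) ⊖ # (+ 1) ⊜ # (+ 3) ⊛ b ⊖ a ⊕ # (+ 2)) ≡.refl (+ a) (+ b)
    ; shift₂ = λ a b → ℤ-Solver.solve 2 (λ a b →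
        (# (+ 4) ⊛ b ⊖ # (+ 2) ⊛ (# (+ 1) ⊕ a) ⊕ # (+ 1)) ⊕ (# (+ 3) ⊛ b ⊖ (# (+ 1) ⊕ a) ⊕ # (+ 3)) ⊕ a ⊖ # (+ 3) ⊛ b ⊜
        # (+ 4) ⊛ b ⊖ # (+ 2) ⊛ a ⊕ # (+ 1) ⊕ # (+ 0)) ≡.refl (+ a) (+ b)
    ; top₂   = λ a b → ℤ-Solver.solve 2 (λ a b →
        # (+ 3) ⊛ b ⊖ (# (+ 1) ⊕ a) ⊕ # (+ 3) ⊖ # (+ 1) ⊜ # (+ 3) ⊛ b ⊖ a ⊕ # (+ 1)) ≡.refl (+ a) (+ b)
    }

  module _ (sum : Label → ℂ) (hasSum : ∀ i → term i HasSum sum i) where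

    private
      cells-sum : ∀ i → cells i HasSum sum i
      cells-sum i = HasSum-cells (hasSum i)

    F-relation : sum F₀ ≈ sum F₁ + q ^ 2 * sum F₂ + 1ᶜ
    F-relation = relation+1 F-recurrence (λ b ()) cell-origin (cell-zero (+ 0) -[1+ 0 ] 0 0 ≡.refl)
      (cells-sum F₀) (cells-sum F₁) (cells-sum F₂)

    G-relation : sum G₀ ≈ sum G₁ + q ^ 2 * sum G₂
    G-relation = relation G-recurrence (λ { zero () ; (suc b) () }) (cells-sum G₀) (cells-sum G₁) (cells-sum G₂)

    F⋆-relation : sum F₂⋆ ≈ sum F₀⋆ + sum F₁⋆ + 1ᶜ
    F⋆-relation = trans
      (relation+1 F⋆-recurrence (λ b ()) cell-origin (cell-zero (+ 0) -[1+ 0 ] 0 0 ≡.refl)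
        (cells-sum F₂⋆) (cells-sum F₀⋆) (cells-sum F₁⋆))
      (+-congʳ {x = 1ᶜ} (+-congˡ {x = sum F₀⋆} (*-identityˡ (sum F₁⋆))))

    G⋆-relation : sum G₂⋆ ≈ sum G₀⋆ + sum G₁⋆
    G⋆-relation = trans
      (relation G⋆-recurrence (λ { zero () ; (suc b) () }) (cells-sum G₂⋆) (cells-sum G₀⋆) (cells-sum G₁⋆))
      (+-congˡ {x = sum G₀⋆} (*-identityˡ (sum G₁⋆)))

theorem7p1 : ∀ {c ℓ₁ ℓ₂ : Level} (ℛ : RealNumbers c ℓ₁ ℓ₂) →
    let open ComplexNumbers ℛ in
    (q : ℂ) (0<∣q∣ : 0<∣ q ∣) (∣q∣<1 : ∣ q ∣< 1ᵣ) →
    let open DoubleSeries ℛ q 0<∣q∣ ∣q∣<1 in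
    (∀ i → Summable (term i)) ×
    (∀ (sum : Label → ℂ) → (∀ i → term i HasSum sum i) →
    (sum F₀ ≈ sum F₁ + q ^ 2 * sum F₂ + 1ᶜ) ×
    (sum G₀ ≈ sum G₁ + q ^ 2 * sum G₂) ×
    (sum F₂⋆ ≈ sum F₀⋆ + sum F₁⋆ + 1ᶜ) ×
    (sum G₂⋆ ≈ sum G₀⋆ + sum G₁⋆))
theorem7p1 ℛ q 0<∣q∣ ∣q∣<1 = term-summable , λ sum hasSum →
    F-relation sum hasSum , G-relation sum hasSum , F⋆-relation sum hasSum , G⋆-relation sum hasSum
  where open QSeries ℛ q 0<∣q∣ ∣q∣<1
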